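{- Let $a,b\ge2$ be integers. The chromatic symmetric function of $C_a+C_b$ (two cycles, with $a$ and $b$ vertices, sharing exactly one vertex) is $$X_{C_a+C_b}(\boldsymbol{x})=\sum_{\substack{\alpha\models a,\ \beta\models b+\alpha_1\\ \mathrm{len}(\beta)\ge 2,\ \beta_1\le \alpha_1,\ \beta_2\ge \alpha_1}}(\alpha_1-1)\cdots(\alpha_l-1)\cdot(\beta_2-\beta_1+1)(\beta_1+\beta_2-\alpha_1-1)\cdot(\beta_3-1)\cdots(\beta_l-1)\cdot e_{\mathrm{sort}(\alpha\setminus\alpha_1\,\cdot\,\beta\setminus\beta_1\,\cdot\,(\beta_1-1))}.$$
   Context: $C_a$ is the cycle graph on $\{1,\dots,a\}$ with edges $(1,2),(2,3),\dots,(a-1,a),(a,1)$ (for $a=2$ this is a single edge). If $G_1,G_2$ are graphs with vertices labeled $1,\dots,k_1$ and $1,\dots,k_2$, then $G_1+G_2$ is the graph on $\{1,\dots,k_1+k_2-1\}$ with edge set $E(G_1)\cup\{(i+k_1-1,j+k_1-1):(i,j)\in E(G_2)\}$, i.e. the last vertex of $G_1$ is identified with the first vertex of $G_2$. The chromatic symmetric function of a graph $G$ is $X_G(\boldsymbol{x})=\sum_\kappa\prod_{v\in V(G)}x_{\kappa(v)}$, summed over proper colorings $\kappa:V(G)\to\mathbb{N}$, in infinitely many variables $\boldsymbol{x}=(x_i)_{i\in\mathbb{N}}$. $e_k=\sum_{i_1<\cdots<i_k}x_{i_1}\cdots x_{i_k}$, $e_0=1$, and $e_\lambda=\prod_i e_{\lambda_i}$.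 $\alpha\models n$ means that $\alpha=(\alpha_1,\dots,\alpha_l)$ is a composition of $n$ (a tuple of positive integers with sum $n$); $\mathrm{len}(\alpha)$ is its number of parts. The subscript $l$ always denotes the last index of the composition in question (so $\alpha_l$ and $\beta_l$ are the last parts of $\alpha$ and $\beta$, whose lengths may differ). $\alpha\setminus\alpha_1$ is $\alpha$ with its first part deleted, $\cdot$ between tuples is concatenation, $\mathrm{sort}$ rearranges a tuple in weakly decreasing order, and a part equal to $0$ (occurring when $\beta_1=1$) contributes the factor $e_0=1$. Empty products equal $1$ (e.g. $(\beta_3-1)\cdots(\beta_l-1)=1$ when $\mathrm{len}(\beta)=2$). -}

module Defs where

open import Data.Empty using (⊥)
open import Data.Fin.Base as Fin using (Fin; zero; suc; inject₁; fromℕ; _↑ˡ_; _↑ʳ_)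
open import Data.Integer.Base as ℤ using (ℤ; +_; 0ℤ; 1ℤ)
open import Data.List.Base as List
  using (List; []; _∷_; _++_; [_]; map; concatMap; cartesianProductWith; filter; foldr; length; upTo; allFin)
import Data.List.Sort as Sort
open import Data.List.Relation.Unary.All as All using (All)
open import Data.Nat.Base using (ℕ; zero; suc; _+_; _∸_; _≤_; _<_)
open import Data.Nat.Properties using (_≟_; _<?_; _≤?_; ≤-decTotalOrder; +-suc)
open import Data.Product.Base as Product using (_×_; _,_)
open import Data.Vec.Base as Vec using (Vec; lookup; toList)
open import Data.Vec.Relation.Unary.Linked as Linked using (Linked)
open import Relation.Binary.Properties.DecTotalOrder ≤-decTotalOrder using (≥-decTotalOrder)
open import Relation.Binary.PropositionalEquality.Core using (_≡_; _≢_; sym)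
open import Relation.Nullary.Decidable using (Dec; yes; no; ¬?; _×-dec_)

-- The ring ℤ[[x₀, x₁, x₂, …]].

-- The list d₀ ∷ … ∷ dₖ₋₁ ∷ [] stands for the monomial x₀^d₀ ⋯ xₖ₋₁^dₖ₋₁;
-- trailing zeros are allowed and do not change the monomial.
Monomial : Set
Monomial = List ℕ

-- A series is given by its coefficients.
Series : Set
Series = Monomial → ℤ

infix 4 _≈_
_≈_ : Series → Series → Set
f ≈ g = ∀ m → f m ≡ g m

sumℤ productℤ : List ℤ → ℤ
sumℤ     = foldr ℤ._+_ 0ℤ
productℤ = foldr ℤ._*_ 1ℤ

-- All (p , q) with p · q = m.
splittings : Monomial → List (Monomial × Monomial)
splittings []      = [ [] , [] ]
splittings (d ∷ m) =
  cartesianProductWith (λ i (p , q) → (i ∷ p) , (d ∸ i ∷ q)) (upTo (suc d)) (splittings m)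

infixl 6 _⊞_
infixl 7 _⊠_
infixr 7 _·_

_⊞_ _⊠_ : Series → Series → Series
(f ⊞ g) m = f m ℤ.+ g m
(f ⊠ g) m = sumℤ (map (λ (p , q) → f p ℤ.* g q) (splittings m))

_·_ : ℤ → Series → Series
(c · f) m = c ℤ.* f m

𝟘 𝟙 : Series
𝟘 _           = 0ℤ
𝟙 []          = 1ℤ
𝟙 (zero  ∷ m) = 𝟙 m
𝟙 (suc _ ∷ _) = 0ℤ

x : ℕ → Series
x _       []            = 0ℤ
x zero    (zero    ∷ _) = 0ℤ
x zero    (suc d   ∷ m) = 𝟙 (d ∷ m)
x (suc i) (zero    ∷ m) = x i m
x (suc _) (suc _   ∷ _) = 0ℤ

∑ ∏ : {A : Set} → List A → (A → Series) → Series
∑ is f = foldr (λ i → f i ⊞_) 𝟘 is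
∏ is f = foldr (λ i → f i ⊠_) 𝟙 is

infix 5 ∑ ∏
syntax ∑ is (λ i → f) = ∑[ i ← is ] f
syntax ∏ is (λ i → f) = ∏[ i ← is ] f

-- All k-tuples with entries in {0, …, N - 1}.
tuples : (k N : ℕ) → List (Vec ℕ k)
tuples zero    N = [ Vec.[] ]
tuples (suc k) N = cartesianProductWith Vec._∷_ (upTo N) (tuples k N)

-- The infinite sum  ∑ x_{i₁} ⋯ x_{iₖ}  over all tuples (i₁, …, iₖ) of natural
-- numbers satisfying P.  A term in which some index is at least length m does
-- not involve the monomial m, so the coefficient at m is computed from the
-- finitely many tuples with entries below length m.
∑∞ : ∀ {k} {P : Vec ℕ k → Set} → (∀ i → Dec (P i)) → Series
∑∞ {k} P? m = (∑[ i ← filter P? (tuples k (length m)) ] ∏[ j ← toList i ] x j) m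

-- A graph on the vertices Fin k is given by a list of its edges; orientation
-- and multiplicity of the entries are irrelevant below.  The vertices are
-- numbered from 0 instead of 1.
Graph : ℕ → Set
Graph k = List (Fin k × Fin k)

C : ∀ a → Graph a
C zero    = []
C (suc n) = map (λ i → inject₁ i , suc i) (allFin n) ++ [ fromℕ n , zero ]

-- Gluing the last vertex of the first graph to the first vertex of the second.
-- Both vertices exist only in the last clause; the other two are junk values.
infixl 6 _⊕_
_⊕_ : ∀ {k₁ k₂} → Graph k₁ → Graph k₂ → Graph (k₁ + k₂ ∸ 1)
_⊕_ {zero}   {_}      _  _  = []
_⊕_ {suc _}  {zero}   _  _  = []
_⊕_ {suc k₁} {suc k₂} G₁ G₂ = map (Product.map left left) G₁ ++ map (Product.map right right) G₂
  where
  left : Fin (suc k₁) → Fin (k₁ + suc k₂)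
  left i = Fin.cast (sym (+-suc k₁ k₂)) (i ↑ˡ k₂)

  right : Fin (suc k₂) → Fin (k₁ + suc k₂)
  right j = k₁ ↑ʳ j

Proper : ∀ {k} → Graph k → Vec ℕ k → Set
Proper G κ = All (λ (u , v) → lookup κ u ≢ lookup κ v) G

proper? : ∀ {k} (G : Graph k) κ → Dec (Proper G κ)
proper? G κ = All.all? (λ (u , v) → ¬? (lookup κ u ≟ lookup κ v)) G

X : ∀ {k} → Graph k → Series
X G = ∑∞ (proper? G)

e : ℕ → Series
e k = ∑∞ {k} {Linked _<_} (Linked.linked? _<?_)

e[_] : List ℕ → Series
e[ λs ] = ∏[ k ← λs ] e k

open Sort ≥-decTotalOrder public using (sort)

-- The compositions of n with l parts, listed by their first part suc i.
compositionsOfLength : (l n : ℕ) → List (List ℕ)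
compositionsOfLength zero    zero    = [ [] ]
compositionsOfLength zero    (suc _) = []
compositionsOfLength (suc l) n       =
  concatMap (λ i → map (suc i ∷_) (compositionsOfLength l (n ∸ suc i))) (upTo n)

compositions : ℕ → List (List ℕ)
compositions n = concatMap (λ l → compositionsOfLength l n) (upTo (suc n))

-- The first part; 0 is a junk value.
first : List ℕ → ℕ
first []       = 0
first (α₁ ∷ _) = α₁

-- len β ≥ 2, β₁ ≤ α₁ and β₂ ≥ α₁.
Admissible : List ℕ → List ℕ → Set
Admissible (α₁ ∷ _) (β₁ ∷ β₂ ∷ _) = β₁ ≤ α₁ × α₁ ≤ β₂
Admissible _        _             = ⊥

admissible? : ∀ α β → Dec (Admissible α β)
admissible? []       _             = no λ ()
admissible? (_  ∷ _) []            = no λ ()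
admissible? (_  ∷ _) (_  ∷ [])     = no λ ()
admissible? (α₁ ∷ _) (β₁ ∷ β₂ ∷ _) = (β₁ ≤? α₁) ×-dec (α₁ ≤? β₂)

∏[_-1] : List ℕ → ℤ
∏[ γ -1] = productℤ (map (λ i → + i ℤ.- 1ℤ) γ)

-- The last clauses of coefficient and parts are junk values, as they concern
-- only pairs that are not admissible.
coefficient : List ℕ → List ℕ → ℤ
coefficient α@(α₁ ∷ _) (β₁ ∷ β₂ ∷ β₃₊) =
  ∏[ α -1]
    ℤ.* ((+ β₂ ℤ.- + β₁ ℤ.+ 1ℤ) ℤ.* (+ β₁ ℤ.+ + β₂ ℤ.- + α₁ ℤ.- 1ℤ))
    ℤ.* ∏[ β₃₊ -1]
coefficient _ _ = 0ℤ

parts : List ℕ → List ℕ → List ℕ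
parts (_ ∷ α₂₊) (β₁ ∷ β₂₊) = α₂₊ ++ β₂₊ ++ [ β₁ ∸ 1 ]
parts _         _          = []

-- Let x be the finitely many variables of the monomials under consideration,
-- x∖d those other than x_d, and h_n = ∑_{γ ⊨ n} ∏ (γᵢ - 1) e_{γᵢ}.  By a transfer
-- matrix recursion, the closed proper walks of n + 1 steps based at d have weight
-- x_d ∑_i i e_i(x∖d) h_{n-i}.  Colouring C_a + C_b amounts to choosing the colour
-- d of the common vertex and one closed walk for each cycle; hence
--
--   X = ∑_{i,j} (i h_{a-1-i}) (j h_{b-1-j}) Q_{i,j},  Q_{i,j} = ∑_d x_d e_i(x∖d) e_j(x∖d).
--
-- The exchange relation Q_{i,j+1} - Q_{i+1,j} = (i - j) e_{i+1} e_{j+1} gives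
-- Q_{i,j} = ∑_{q ≤ min(i,j)} (i + j + 1 - 2q) e_{i+j+1-q} e_q, and the summands of
-- the theorem appear with α₁ = i + 1, β₁ = q + 1 and β₂ = i + j + 1 - q.

module Submission where

import Algebra.Properties.CommutativeMonoid.Sum
open import Algebra.Bundles using (CommutativeMonoid; CommutativeRing)
open import Algebra.Morphism.Structures using (IsRingHomomorphism)
open import Data.Bool.Base using (if_then_else_)
open import Data.Fin.Base using (Fin; zero; suc; toℕ; fromℕ; inject₁; cast; _↑ˡ_; _↑ʳ_)
open import Data.Fin.Properties using (toℕ<n; toℕ-fromℕ; toℕ-inject₁; toℕ-cast; toℕ-↑ˡ; toℕ-↑ʳ)
open import Data.Integer.Base as ℤ using (ℤ; +_; 0ℤ)
import Data.Integer.Properties as ℤ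
open import Data.Integer.Tactic.RingSolver using (solve-∀)
open import Data.List.Base
  using (List; []; _∷_; _++_; [_]; map; concatMap; cartesianProductWith; filter; foldr; length; upTo; applyUpTo; tabulate; allFin; drop)
open import Data.List.Relation.Binary.Permutation.Propositional using (_↭_; ↭-sym; ↭⇒↭ₛ′)
open import Data.List.Relation.Binary.Permutation.Propositional.Properties using (map⁺)
import Data.List.Relation.Unary.All as All
open import Data.Nat.Base using (ℕ; zero; suc; _+_; _∸_; _≤_; _<_; z≤n; s≤s)
open import Data.Nat.Properties as ℕ using (_≟_; _≤?_; _<?_; ≤-decTotalOrder)
open import Data.Product.Base as Product using (_×_; _,_)
open import Data.Sum.Base using (inj₁; inj₂)
open import Data.Vec.Base as Vec using (Vec; lookup; toList)
import Data.Vec.Relation.Unary.Linked as Linked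
open import Function.Base using (_∘_; id)
open import Function.Bundles using (_⇔_; mk⇔)
open import Level using (0ℓ)
open import Relation.Binary.Properties.DecTotalOrder ≤-decTotalOrder using (≥-decTotalOrder)
open import Relation.Binary.PropositionalEquality.Core as ≡ using (_≡_; _≢_)
open import Relation.Binary.PropositionalEquality.Properties using (module ≡-Reasoning)
open import Relation.Nullary.Decidable using (Dec; yes; no; does; ¬?; _×-dec_; does-⇔; dec-true; dec-false)
open import Relation.Nullary.Negation using (¬_; contradiction)
open import Data.List.Sort ≥-decTotalOrder using (sort-↭)
open import Defs using (tuples; compositionsOfLength; compositions; first; admissible?; ∏[_-1]; coefficient; parts; C; _⊕_; proper?)

-- Finite sums and products

-- One step away from `d` leads to walks that are no longer closed, so the recursion has to run on
-- all pairs of ends, not only on closed walks. The form of the answer comes from a resolvent. With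
-- D the diagonal matrix of the variables and J the all-ones matrix, 1 - z(J - I)D = (1 + zD) - zJD
-- is a rank-one perturbation of a diagonal matrix. Let E(z) be the product of all 1 + z x_i.
-- Inverting and multiplying by E leaves the denominator E - zE' = 1 - ∑ (i - 1) e_i z^i, whose
-- inverse is ∑ h_n z^n. The numerators are the product of the 1 + z x_i over i ≠ c, d off the
-- diagonal, and z d/dz of the product over i ≠ d on it; their coefficients are `u`. The proof
-- verifies these coefficients by induction and inverts nothing.
--
-- The definition of `∑∞` lets the number of variables depend on the monomial. Hence the
-- combinatorics takes place in an arbitrary commutative ring with N given elements, and is
-- specialised to series compared on monomials of length N only.

module BigOperator (M : CommutativeMonoid 0ℓ 0ℓ) where
  open CommutativeMonoid M
  import Data.List.Relation.Binary.Permutation.Setoid.Properties setoid as Perm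
  open import Algebra.Properties.CommutativeMonoid.Sum M
  open import Relation.Binary.Reasoning.Setoid setoid

  big : {A : Set} → List A → (A → Carrier) → Carrier
  big is f = foldr (λ i → f i ∙_) ε is

  big< : ℕ → (ℕ → Carrier) → Carrier
  big< n f = sum {n} (f ∘ toℕ)

  big-cong : {A : Set} (is : List A) {f g : A → Carrier} → (∀ i → f i ≈ g i) → big is f ≈ big is g
  big-cong []       f≈g = refl
  big-cong (i ∷ is) f≈g = ∙-cong (f≈g i) (big-cong is f≈g)

  big-++ : {A : Set} (is js : List A) (f : A → Carrier) → big (is ++ js) f ≈ big is f ∙ big js f
  big-++ []       js f = sym (identityˡ _)
  big-++ (i ∷ is) js f = trans (∙-congˡ (big-++ is js f)) (sym (assoc _ _ _))

  big-map : {A B : Set} (h : A → B) (is : List A) (f : B → Carrier) → big (map h is) f ≡ big is (f ∘ h)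
  big-map h []       f = ≡.refl
  big-map h (i ∷ is) f = ≡.cong (f (h i) ∙_) (big-map h is f)

  big-concatMap : {A B : Set} (h : A → List B) (is : List A) (f : B → Carrier) →
                  big (concatMap h is) f ≈ big is (λ i → big (h i) f)
  big-concatMap h []       f = refl
  big-concatMap h (i ∷ is) f = trans (big-++ (h i) _ f) (∙-congˡ (big-concatMap h is f))

  big-cartesianProductWith : {A B D : Set} (h : A → B → D) (is : List A) (js : List B) (f : D → Carrier) →
                             big (cartesianProductWith h is js) f ≈ big is (λ i → big js (f ∘ h i))
  big-cartesianProductWith h []       js f = refl
  big-cartesianProductWith h (i ∷ is) js f = trans (big-++ (map (h i) js) _ f)
    (∙-cong (reflexive (big-map (h i) js f)) (big-cartesianProductWith h is js f))

  big-↭ : {A : Set} {is js : List A} (f : A → Carrier) → is ↭ js → big is f ≈ big js f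
  big-↭ {is = is} {js} f is↭js = begin
    big is f                ≡⟨ big-map f is id ⟨
    foldr _∙_ ε (map f is)  ≈⟨ Perm.foldr-commMonoid isCommutativeMonoid (↭⇒↭ₛ′ isEquivalence (map⁺ f is↭js)) ⟩
    foldr _∙_ ε (map f js)  ≡⟨ big-map f js id ⟩
    big js f                ∎

  big-applyUpTo : {A : Set} (h : ℕ → A) (n : ℕ) (f : A → Carrier) → big (applyUpTo h n) f ≡ big< n (f ∘ h)
  big-applyUpTo h zero    f = ≡.refl
  big-applyUpTo h (suc n) f = ≡.cong (f (h 0) ∙_) (big-applyUpTo (h ∘ suc) n f)

  big-upTo : (n : ℕ) (f : ℕ → Carrier) → big (upTo n) f ≡ big< n f
  big-upTo = big-applyUpTo id

  big-tabulate : {A : Set} {n : ℕ} (h : Fin n → A) (f : A → Carrier) → big (tabulate h) f ≡ sum (f ∘ h)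
  big-tabulate {n = zero}  h f = ≡.refl
  big-tabulate {n = suc n} h f = ≡.cong (f (h zero) ∙_) (big-tabulate (h ∘ suc) f)

  big<-cong-< : ∀ n {f g} → (∀ i → i < n → f i ≈ g i) → big< n f ≈ big< n g
  big<-cong-< n f≈g = sum-cong-≋ {n} (λ i → f≈g (toℕ i) (toℕ<n i))

  big<-cong : ∀ n {f g} → (∀ i → f i ≈ g i) → big< n f ≈ big< n g
  big<-cong n f≈g = big<-cong-< n (λ i _ → f≈g i)

  big<-ε : ∀ n {f} → (∀ i → f i ≈ ε) → big< n f ≈ ε
  big<-ε n f≈ε = trans (big<-cong n f≈ε) (sum-replicate-zero n)

  big<-∙ : ∀ n f g → big< n (λ i → f i ∙ g i) ≈ big< n f ∙ big< n g
  big<-∙ n f g = ∑-distrib-+ {n} (f ∘ toℕ) (g ∘ toℕ)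

  big<-comm : ∀ m n (f : ℕ → ℕ → Carrier) →
              big< m (λ i → big< n (λ j → f i j)) ≈ big< n (λ j → big< m (λ i → f i j))
  big<-comm m n f = ∑-comm {m} {n} (λ i j → f (toℕ i) (toℕ j))

  big<-last : ∀ n f → big< (suc n) f ≈ big< n f ∙ f n
  big<-last zero    f = comm _ _
  big<-last (suc n) f = trans (∙-congˡ (big<-last n (f ∘ suc))) (sym (assoc _ _ _))

  big<-extend : ∀ m n f → (∀ i → m ≤ i → f i ≈ ε) → big< (m + n) f ≈ big< m f
  big<-extend zero    n f f≈ε = big<-ε n (λ i → f≈ε i z≤n)
  big<-extend (suc m) n f f≈ε = ∙-congˡ (big<-extend m n (f ∘ suc) (λ i m≤i → f≈ε (suc i) (s≤s m≤i)))

  big<-extend-≤ : ∀ {m n} f → m ≤ n → (∀ i → m ≤ i → f i ≈ ε) → big< n f ≈ big< m f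
  big<-extend-≤ {m} {n} f m≤n f≈ε =
    trans (reflexive (≡.cong (λ k → big< k f) (≡.sym (ℕ.m+[n∸m]≡n m≤n)))) (big<-extend m (n ∸ m) f f≈ε)

  -- Both sides are sums over the pairs (i , j) with i + j = d.
  big<-reverse : ∀ d (F : ℕ → ℕ → Carrier) →
                 big< (suc d) (λ i → F i (d ∸ i)) ≈ big< (suc d) (λ i → F (d ∸ i) i)
  big<-reverse zero    F = refl
  big<-reverse (suc d) F = begin
    F 0 (suc d) ∙ big< (suc d) (λ i → F (suc i) (d ∸ i))         ≈⟨ ∙-congˡ (big<-reverse d (F ∘ suc)) ⟩
    F 0 (suc d) ∙ big< (suc d) (λ i → F (suc (d ∸ i)) i)         ≈⟨ comm _ _ ⟩
    big< (suc d) (λ i → F (suc (d ∸ i)) i) ∙ F 0 (suc d)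
      ≈⟨ ∙-cong (big<-cong-< (suc d) (λ i i≤d → reflexive (≡.cong (λ k → F k i) (≡.sym (ℕ.+-∸-assoc 1 (ℕ.≤-pred i≤d))))))
                (reflexive (≡.cong (λ k → F k (suc d)) (≡.sym (ℕ.n∸n≡0 (suc d))))) ⟩
    big< (suc d) (λ i → F (suc d ∸ i) i) ∙ F (suc d ∸ suc d) (suc d) ≈⟨ big<-last (suc d) (λ i → F (suc d ∸ i) i) ⟨
    big< (suc (suc d)) (λ i → F (suc d ∸ i) i)                   ∎

  -- Both sides run over the triples (j , i , k) with j + i + k = d. This is what associativity of a
  -- Cauchy product needs.
  big<-triangle : ∀ d (G : ℕ → ℕ → ℕ → Carrier) →
    big< (suc d) (λ i → big< (suc i) (λ j → G j (i ∸ j) (d ∸ i)))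
      ≈ big< (suc d) (λ j → big< (suc (d ∸ j)) (λ i → G j i (d ∸ j ∸ i)))
  big<-triangle zero    G = refl
  big<-triangle (suc d) G = begin
    (G 0 0 (suc d) ∙ ε) ∙ big< (suc d) (λ i → G 0 (suc i) (d ∸ i) ∙ big< (suc i) (λ j → G (suc j) (i ∸ j) (d ∸ i)))
      ≈⟨ ∙-cong (identityʳ _) (big<-∙ (suc d) (λ i → G 0 (suc i) (d ∸ i)) (λ i → big< (suc i) (λ j → G (suc j) (i ∸ j) (d ∸ i)))) ⟩
    G 0 0 (suc d) ∙ (big< (suc d) (λ i → G 0 (suc i) (d ∸ i))
      ∙ big< (suc d) (λ i → big< (suc i) (λ j → G (suc j) (i ∸ j) (d ∸ i))))
      ≈⟨ ∙-congˡ (∙-congˡ (big<-triangle d (G ∘ suc))) ⟩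
    G 0 0 (suc d) ∙ (big< (suc d) (λ i → G 0 (suc i) (d ∸ i))
      ∙ big< (suc d) (λ j → big< (suc (d ∸ j)) (λ i → G (suc j) i (d ∸ j ∸ i))))
      ≈⟨ assoc _ _ _ ⟨
    big< (suc (suc d)) (λ j → big< (suc (suc d ∸ j)) (λ i → G j i (suc d ∸ j ∸ i))) ∎

-- Symmetric functions, compositions and colourings

module Weights (R : CommutativeRing 0ℓ 0ℓ) where
  open CommutativeRing R hiding (zero) renaming (_+_ to _+ᴿ_; _-_ to _-ᴿ_; -_ to -ᴿ_)
  open import Algebra.Properties.Semiring.Sum semiring using (*-distribˡ-sum; *-distribʳ-sum)
  open import Relation.Binary.Reasoning.Setoid setoid
  open import Algebra.Solver.Ring.NaturalCoefficients.Default commutativeSemiring using (solve; _:=_; _:+_; _:*_; con)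

  module Σ = BigOperator +-commutativeMonoid
  module Π = BigOperator *-commutativeMonoid

  open Σ public using () renaming (big to ∑; big< to ∑<)
  open Π public using () renaming (big to ∏; big< to ∏<)

  *-∑<ˡ : ∀ n a (f : ℕ → Carrier) → a * ∑< n f ≈ ∑< n (λ i → a * f i)
  *-∑<ˡ n a f = *-distribˡ-sum {n} a (f ∘ toℕ)

  *-∑<ʳ : ∀ n a (f : ℕ → Carrier) → ∑< n f * a ≈ ∑< n (λ i → f i * a)
  *-∑<ʳ n a f = *-distribʳ-sum {n} a (f ∘ toℕ)

  *-∑ˡ : {A : Set} (a : Carrier) (is : List A) (f : A → Carrier) → a * ∑ is f ≈ ∑ is (λ i → a * f i)
  *-∑ˡ a []       f = zeroʳ a
  *-∑ˡ a (i ∷ is) f = trans (distribˡ a _ _) (+-congˡ (*-∑ˡ a is f))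

  -- Conditions become factors, so that filters can be split, factored and moved through sums by
  -- ring laws.
  ⟦_⟧ : {P : Set} → Dec P → Carrier
  ⟦ P? ⟧ = if does P? then 1# else 0#

  ⟦⟧-yes : {P : Set} (P? : Dec P) → P → ⟦ P? ⟧ ≈ 1#
  ⟦⟧-yes (yes _) p = refl
  ⟦⟧-yes (no ¬p) p = contradiction p ¬p

  ⟦⟧-no : {P : Set} (P? : Dec P) → ¬ P → ⟦ P? ⟧ ≈ 0#
  ⟦⟧-no (yes p) ¬p = contradiction p ¬p
  ⟦⟧-no (no _)  ¬p = refl

  ⟦⟧-⇔ : {P Q : Set} (P? : Dec P) (Q? : Dec Q) → P ⇔ Q → ⟦ P? ⟧ ≈ ⟦ Q? ⟧
  ⟦⟧-⇔ P? Q? P⇔Q = reflexive (≡.cong (if_then 1# else 0#) (does-⇔ P⇔Q P? Q?))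

  ⟦⟧-× : {P Q : Set} (P? : Dec P) (Q? : Dec Q) → ⟦ P? ×-dec Q? ⟧ ≈ ⟦ P? ⟧ * ⟦ Q? ⟧
  ⟦⟧-× (yes _) Q? = sym (*-identityˡ _)
  ⟦⟧-× (no _)  Q? = sym (zeroˡ _)

  ⟦⟧-all : {A : Set} {P : A → Set} (P? : ∀ i → Dec (P i)) (is : List A) →
           ⟦ All.all? P? is ⟧ ≈ ∏ is (λ i → ⟦ P? i ⟧)
  ⟦⟧-all P? []       = refl
  ⟦⟧-all P? (i ∷ is) = trans (⟦⟧-× (P? i) (All.all? P? is)) (*-congˡ (⟦⟧-all P? is))

  ∑-filter : {A : Set} {P : A → Set} (P? : ∀ i → Dec (P i)) (is : List A) (f : A → Carrier) →
             ∑ (filter P? is) f ≈ ∑ is (λ i → ⟦ P? i ⟧ * f i)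
  ∑-filter P? []       f = refl
  ∑-filter P? (i ∷ is) f with P? i
  ... | yes _ = +-cong (sym (*-identityˡ _)) (∑-filter P? is f)
  ... | no _  = trans (∑-filter P? is f) (sym (trans (+-congʳ (zeroˡ _)) (+-identityˡ _)))

  ∑<-from : ∀ n s (f : ℕ → Carrier) → ∑< n (λ i → ⟦ s ≤? i ⟧ * f i) ≈ ∑< (n ∸ s) (λ i → f (s + i))
  ∑<-from n       zero    f = Σ.big<-cong n {λ i → 1# * f i} {f} (λ i → *-identityˡ _)
  ∑<-from zero    (suc s) f = refl
  ∑<-from (suc n) (suc s) f = begin
    0# * f 0 +ᴿ ∑< n (λ i → ⟦ suc s ≤? suc i ⟧ * f (suc i))  ≈⟨ +-congʳ (zeroˡ _) ⟩
    0# +ᴿ ∑< n (λ i → ⟦ suc s ≤? suc i ⟧ * f (suc i))        ≈⟨ +-identityˡ _ ⟩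
    ∑< n (λ i → ⟦ suc s ≤? suc i ⟧ * f (suc i))
      ≈⟨ Σ.big<-cong n {λ i → ⟦ suc s ≤? suc i ⟧ * f (suc i)} {λ i → ⟦ s ≤? i ⟧ * f (suc i)}
           (λ i → *-congʳ (⟦⟧-⇔ (suc s ≤? suc i) (s ≤? i) (mk⇔ ℕ.≤-pred s≤s))) ⟩
    ∑< n (λ i → ⟦ s ≤? i ⟧ * f (suc i))                      ≈⟨ ∑<-from n s (f ∘ suc) ⟩
    ∑< (n ∸ s) (λ i → f (suc s + i))                         ∎

  ∑<-below : ∀ {m n} (f : ℕ → Carrier) → m ≤ n → ∑< n (λ i → ⟦ suc i ≤? m ⟧ * f i) ≈ ∑< m f
  ∑<-below {m} {n} f m≤n = trans
    (Σ.big<-extend-≤ (λ i → ⟦ suc i ≤? m ⟧ * f i) m≤n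
      (λ i m≤i → trans (*-congʳ (⟦⟧-no (suc i ≤? m) (ℕ.≤⇒≯ m≤i))) (zeroˡ _)))
    (Σ.big<-cong-< m {λ i → ⟦ suc i ≤? m ⟧ * f i} {f}
      (λ i i<m → trans (*-congʳ (⟦⟧-yes (suc i ≤? m) i<m)) (*-identityˡ _)))

  -- Deletion of a variable

  χ : ℕ → ℕ → Carrier
  χ c i = ⟦ ¬? (c ≟ i) ⟧

  χ-refl : ∀ c → χ c c ≈ 0#
  χ-refl c = ⟦⟧-no (¬? (c ≟ c)) (λ c≢c → c≢c ≡.refl)

  χ-≢ : ∀ {c i} → c ≢ i → χ c i ≈ 1#
  χ-≢ {c} {i} = ⟦⟧-yes (¬? (c ≟ i))

  -- The variable `c` is deleted by setting it to zero, which keeps the index range unchanged. The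
  -- same expression is the transfer matrix entry for a proper step from `c` to `i`; this double
  -- role links walks to elementary polynomials.
  mask : ℕ → (ℕ → Carrier) → (ℕ → Carrier)
  mask c y i = χ c i * y i

  ∑<-remove : ∀ {N c} (f : ℕ → Carrier) → c < N → ∑< N f ≈ f c +ᴿ ∑< N (mask c f)
  ∑<-remove {suc N} {zero}  f _         = +-congˡ (begin
    ∑< N (f ∘ suc)                              ≈⟨ Σ.big<-cong N {f ∘ suc} {mask 0 f ∘ suc} (λ i → sym (*-identityˡ _)) ⟩
    ∑< N (mask 0 f ∘ suc)                       ≈⟨ +-identityˡ _ ⟨
    0# +ᴿ ∑< N (mask 0 f ∘ suc)                 ≈⟨ +-congʳ (zeroˡ _) ⟨
    0# * f 0 +ᴿ ∑< N (mask 0 f ∘ suc)           ∎)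
  ∑<-remove {suc N} {suc c} f (s≤s c<N) = begin
    f 0 +ᴿ ∑< N (f ∘ suc)                                ≈⟨ +-cong (sym (*-identityˡ _)) (∑<-remove (f ∘ suc) c<N) ⟩
    1# * f 0 +ᴿ (f (suc c) +ᴿ ∑< N (mask c (f ∘ suc)))   ≈⟨ x∙yz≈y∙xz _ _ _ ⟩
    f (suc c) +ᴿ ∑< (suc N) (mask (suc c) f)             ∎
    where open import Algebra.Properties.CommutativeSemigroup +-commutativeSemigroup using (x∙yz≈y∙xz)

  elementary : ℕ → ℕ → (ℕ → Carrier) → Carrier
  elementary zero    N       y = 1#
  elementary (suc k) zero    y = 0#
  elementary (suc k) (suc N) y = elementary (suc k) N (y ∘ suc) +ᴿ y 0 * elementary k N (y ∘ suc)

  elementary-cong : ∀ k N {y z} → (∀ i → y i ≈ z i) → elementary k N y ≈ elementary k N z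
  elementary-cong zero    N       y≈z = refl
  elementary-cong (suc k) zero    y≈z = refl
  elementary-cong (suc k) (suc N) y≈z =
    +-cong (elementary-cong (suc k) N (y≈z ∘ suc)) (*-cong (y≈z 0) (elementary-cong k N (y≈z ∘ suc)))

  mask-zero : ∀ k N y → elementary k (suc N) (mask 0 y) ≈ elementary k N (y ∘ suc)
  mask-zero zero    N y = refl
  mask-zero (suc k) N y = begin
    elementary (suc k) N (mask 0 y ∘ suc) +ᴿ (0# * y 0) * elementary k N (mask 0 y ∘ suc)
      ≈⟨ +-cong (elementary-cong (suc k) N (λ i → *-identityˡ _)) (trans (*-congʳ (zeroˡ _)) (zeroˡ _)) ⟩
    elementary (suc k) N (y ∘ suc) +ᴿ 0#  ≈⟨ +-identityʳ _ ⟩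
    elementary (suc k) N (y ∘ suc)        ∎

  -- A monomial either avoids the variable `c` or contains it once. The definition gives this for
  -- the variable 0; for the others, the expansions at 0 and at `c` are interchanged.
  elementary-remove : ∀ k {N c} y → c < N →
    elementary (suc k) N y ≈ elementary (suc k) N (mask c y) +ᴿ y c * elementary k N (mask c y)
  elementary-remove k {suc N} {zero} y _ =
    sym (+-cong (mask-zero (suc k) N y) (*-congˡ (mask-zero k N y)))
  -- Degree one is treated apart: `elementary k (suc N)` unfolds only for a successor `k`.
  elementary-remove zero {suc N} {suc c} y (s≤s c<N) = begin
    elementary 1 N (y ∘ suc) +ᴿ y 0 * 1#
      ≈⟨ +-congʳ (elementary-remove 0 (y ∘ suc) c<N) ⟩
    (elementary 1 N (mask c (y ∘ suc)) +ᴿ y (suc c) * 1#) +ᴿ y 0 * 1#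
      ≈⟨ solve 3 (λ e a b → (e :+ a :* con 1) :+ b :* con 1 := (e :+ (con 1 :* b) :* con 1) :+ a :* con 1) refl _ _ _ ⟩
    (elementary 1 N (mask c (y ∘ suc)) +ᴿ (1# * y 0) * 1#) +ᴿ y (suc c) * 1# ∎
  elementary-remove (suc k) {suc N} {suc c} y (s≤s c<N) = begin
    elementary (suc (suc k)) N (y ∘ suc) +ᴿ y 0 * elementary (suc k) N (y ∘ suc)
      ≈⟨ +-cong (elementary-remove (suc k) (y ∘ suc) c<N) (*-congˡ (elementary-remove k (y ∘ suc) c<N)) ⟩
    (e₂ +ᴿ y (suc c) * e₁) +ᴿ y 0 * (e₁ +ᴿ y (suc c) * e₀)
      ≈⟨ solve 5 (λ e₀ e₁ e₂ a b → (e₂ :+ a :* e₁) :+ b :* (e₁ :+ a :* e₀)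
                    := (e₂ :+ (con 1 :* b) :* e₁) :+ a :* (e₁ :+ (con 1 :* b) :* e₀)) refl e₀ e₁ e₂ _ _ ⟩
    (e₂ +ᴿ (1# * y 0) * e₁) +ᴿ y (suc c) * (e₁ +ᴿ (1# * y 0) * e₀) ∎
    where
    e₀ = elementary k N (mask c (y ∘ suc))
    e₁ = elementary (suc k) N (mask c (y ∘ suc))
    e₂ = elementary (suc (suc k)) N (mask c (y ∘ suc))

  -- Sums over compositions

  ∑-compositionsOfLength : ∀ l n (f : List ℕ → Carrier) →
    ∑ (compositionsOfLength (suc l) n) f ≈ ∑< n (λ i → ∑ (compositionsOfLength l (n ∸ suc i)) (f ∘ (suc i ∷_)))
  ∑-compositionsOfLength l n f = begin
    ∑ (compositionsOfLength (suc l) n) f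
      ≈⟨ Σ.big-concatMap (λ i → map (suc i ∷_) (compositionsOfLength l (n ∸ suc i))) (upTo n) f ⟩
    ∑ (upTo n) (λ i → ∑ (map (suc i ∷_) (compositionsOfLength l (n ∸ suc i))) f)
      ≈⟨ Σ.big-cong (upTo n) (λ i → reflexive (Σ.big-map (suc i ∷_) (compositionsOfLength l (n ∸ suc i)) f)) ⟩
    ∑ (upTo n) (λ i → ∑ (compositionsOfLength l (n ∸ suc i)) (f ∘ (suc i ∷_)))
      ≡⟨ Σ.big-upTo n _ ⟩
    ∑< n (λ i → ∑ (compositionsOfLength l (n ∸ suc i)) (f ∘ (suc i ∷_))) ∎

  ∑-compositionsOfLength-> : ∀ {l n} (f : List ℕ → Carrier) → n < l → ∑ (compositionsOfLength l n) f ≈ 0#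
  ∑-compositionsOfLength-> {suc l} {n} f (s≤s n≤l) = begin
    ∑ (compositionsOfLength (suc l) n) f                                      ≈⟨ ∑-compositionsOfLength l n f ⟩
    ∑< n (λ i → ∑ (compositionsOfLength l (n ∸ suc i)) (f ∘ (suc i ∷_)))
      ≈⟨ Σ.big<-cong-< n {λ i → ∑ (compositionsOfLength l (n ∸ suc i)) (f ∘ (suc i ∷_))} {λ _ → 0#}
           (λ i i<n → ∑-compositionsOfLength-> (f ∘ (suc i ∷_)) (ℕ.<-≤-trans (ℕ.∸-monoʳ-< (s≤s z≤n) i<n) n≤l)) ⟩
    ∑< n (λ _ → 0#)                                                           ≈⟨ Σ.big<-ε n (λ _ → refl) ⟩
    0#                                                                        ∎

  -- Compositions are enumerated by length, whereas every recursion below is by the first part; the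
  -- two summations are exchanged.
  ∑-compositions-first : ∀ n (f : List ℕ → Carrier) →
    ∑ (compositions n) f
      ≈ ∑ (compositionsOfLength 0 n) f +ᴿ ∑< n (λ i → ∑ (compositions (n ∸ suc i)) (f ∘ (suc i ∷_)))
  ∑-compositions-first n f = begin
    ∑ (compositions n) f
      ≈⟨ byLength n f ⟩
    ∑ (compositionsOfLength 0 n) f +ᴿ ∑< n (λ l → ∑ (compositionsOfLength (suc l) n) f)
      ≈⟨ +-congˡ (Σ.big<-cong n {λ l → ∑ (compositionsOfLength (suc l) n) f} {λ l → ∑< n (rest l)}
                   (λ l → ∑-compositionsOfLength l n f)) ⟩
    ∑ (compositionsOfLength 0 n) f +ᴿ ∑< n (λ l → ∑< n (λ i → rest l i))
      ≈⟨ +-congˡ (Σ.big<-comm n n rest) ⟩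
    ∑ (compositionsOfLength 0 n) f +ᴿ ∑< n (λ i → ∑< n (λ l → rest l i))
      ≈⟨ +-congˡ (Σ.big<-cong-< n {λ i → ∑< n (λ l → rest l i)} {λ i → ∑ (compositions (n ∸ suc i)) (f ∘ (suc i ∷_))}
           -- A composition has no more parts than its size, so the lengths beyond `n ∸ suc i`
           -- contribute nothing.
           (λ i i<n → trans
              (Σ.big<-extend-≤ (λ l → rest l i) (ℕ.∸-monoʳ-< (s≤s z≤n) i<n)
                (λ l → ∑-compositionsOfLength-> (f ∘ (suc i ∷_))))
              (sym (byLength (n ∸ suc i) (f ∘ (suc i ∷_)))))) ⟩
    ∑ (compositionsOfLength 0 n) f +ᴿ ∑< n (λ i → ∑ (compositions (n ∸ suc i)) (f ∘ (suc i ∷_))) ∎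
    where
    rest : ℕ → ℕ → Carrier
    rest l i = ∑ (compositionsOfLength l (n ∸ suc i)) (f ∘ (suc i ∷_))

    byLength : ∀ n (f : List ℕ → Carrier) →
               ∑ (compositions n) f ≈ ∑< (suc n) (λ l → ∑ (compositionsOfLength l n) f)
    byLength n f = trans (Σ.big-concatMap (λ l → compositionsOfLength l n) (upTo (suc n)) f)
                         (reflexive (Σ.big-upTo (suc n) _))

  ∑-compositions-suc : ∀ n (f : List ℕ → Carrier) →
    ∑ (compositions (suc n)) f ≈ ∑< (suc n) (λ i → ∑ (compositions (n ∸ i)) (f ∘ (suc i ∷_)))
  ∑-compositions-suc n f = trans (∑-compositions-first (suc n) f) (+-identityˡ _)

  ∑-compositions-nonempty : ∀ n (f : List ℕ → Carrier) → f [] ≈ 0# →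
    ∑ (compositions n) f ≈ ∑< n (λ i → ∑ (compositions (n ∸ suc i)) (f ∘ (suc i ∷_)))
  ∑-compositions-nonempty zero    f f[]≈0 = trans (+-identityʳ _) f[]≈0
  ∑-compositions-nonempty (suc n) f _     = ∑-compositions-suc n f

  -- Sums over tuples, and elementary polynomials as sums over increasing tuples

  ∑tuples : (k N : ℕ) → (List ℕ → Carrier) → Carrier
  ∑tuples zero    N F = F []
  ∑tuples (suc k) N F = ∑< N (λ c → ∑tuples k N (F ∘ (c ∷_)))

  -- Summands on lists instead of vectors spare all transport along equations between lengths when a
  -- colouring is cut into its two cycles.
  ∑-tuples : ∀ k N (F : List ℕ → Carrier) → ∑ (tuples k N) (F ∘ toList) ≈ ∑tuples k N F
  ∑-tuples zero    N F = +-identityʳ _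
  ∑-tuples (suc k) N F = begin
    ∑ (tuples (suc k) N) (F ∘ toList)
      ≈⟨ Σ.big-cartesianProductWith Vec._∷_ (upTo N) (tuples k N) (F ∘ toList) ⟩
    ∑ (upTo N) (λ c → ∑ (tuples k N) (F ∘ (c ∷_) ∘ toList))
      ≈⟨ Σ.big-cong (upTo N) (λ c → ∑-tuples k N (F ∘ (c ∷_))) ⟩
    ∑ (upTo N) (λ c → ∑tuples k N (F ∘ (c ∷_)))
      ≡⟨ Σ.big-upTo N _ ⟩
    ∑tuples (suc k) N F ∎

  ∑tuples-cong : ∀ k N {F G : List ℕ → Carrier} → (∀ t → F t ≈ G t) → ∑tuples k N F ≈ ∑tuples k N G
  ∑tuples-cong zero    N         F≈G = F≈G []
  ∑tuples-cong (suc k) N {F} {G} F≈G =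
    Σ.big<-cong N {λ c → ∑tuples k N (F ∘ (c ∷_))} {λ c → ∑tuples k N (G ∘ (c ∷_))}
      (λ c → ∑tuples-cong k N (F≈G ∘ (c ∷_)))

  *-∑tuples : ∀ k N a (F : List ℕ → Carrier) → a * ∑tuples k N F ≈ ∑tuples k N (λ t → a * F t)
  *-∑tuples zero    N a F = refl
  *-∑tuples (suc k) N a F = trans (*-∑<ˡ N a (λ c → ∑tuples k N (F ∘ (c ∷_))))
    (Σ.big<-cong N {λ c → a * ∑tuples k N (F ∘ (c ∷_))} {λ c → ∑tuples k N (λ t → a * F (c ∷ t))}
      (λ c → *-∑tuples k N a (F ∘ (c ∷_))))

  -- The monomials are classified by their least index `s`, as in an increasing tuple.
  elementary-first : ∀ k M y →
    elementary (suc k) M y ≈ ∑< M (λ s → y s * elementary k (M ∸ suc s) (λ i → y (suc s + i)))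
  elementary-first k zero    y = refl
  elementary-first k (suc M) y = trans (+-comm _ _) (+-congˡ (elementary-first k M (y ∘ suc)))

  -- The explicit lower bound makes the condition on the tail one of the same kind, so that the tail
  -- sums to an elementary polynomial in the variables above the first entry.
  ascending : ℕ → List ℕ → Carrier
  ascending lo []      = 1#
  ascending lo (i ∷ t) = ⟦ lo ≤? i ⟧ * ascending (suc i) t

  ⟦linked⟧ : ∀ {k} (i : Vec ℕ k) → ⟦ Linked.linked? _<?_ i ⟧ ≈ ascending 0 (toList i)
  ⟦linked⟧ Vec.[]      = refl
  ⟦linked⟧ (i Vec.∷ t) = trans (go i t) (sym (*-identityˡ _))
    where
    go : ∀ {k} i (t : Vec ℕ k) → ⟦ Linked.linked? _<?_ (i Vec.∷ t) ⟧ ≈ ascending (suc i) (toList t)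
    go i Vec.[]      = refl
    go i (j Vec.∷ t) = begin
      ⟦ Linked.linked? _<?_ (i Vec.∷ j Vec.∷ t) ⟧
        ≈⟨ ⟦⟧-⇔ (Linked.linked? _<?_ (i Vec.∷ j Vec.∷ t)) (suc i ≤? j ×-dec Linked.linked? _<?_ (j Vec.∷ t))
             (mk⇔ (λ { (i<j Linked.∷ l) → i<j , l }) (λ (i<j , l) → i<j Linked.∷ l)) ⟩
      ⟦ suc i ≤? j ×-dec Linked.linked? _<?_ (j Vec.∷ t) ⟧   ≈⟨ ⟦⟧-× (suc i ≤? j) (Linked.linked? _<?_ (j Vec.∷ t)) ⟩
      ⟦ suc i ≤? j ⟧ * ⟦ Linked.linked? _<?_ (j Vec.∷ t) ⟧   ≈⟨ *-congˡ (go j t) ⟩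
      ⟦ suc i ≤? j ⟧ * ascending (suc j) (toList t)          ∎

  ∑tuples-ascending : ∀ k N lo (x : ℕ → Carrier) →
    ∑tuples k N (λ t → ascending lo t * ∏ t x) ≈ elementary k (N ∸ lo) (λ i → x (lo + i))
  ∑tuples-ascending zero    N lo x = *-identityˡ _
  ∑tuples-ascending (suc k) N lo x = begin
    ∑< N (λ c → ∑tuples k N (λ t → (⟦ lo ≤? c ⟧ * ascending (suc c) t) * (x c * ∏ t x)))
      ≈⟨ Σ.big<-cong N {λ c → ∑tuples k N (λ t → (⟦ lo ≤? c ⟧ * ascending (suc c) t) * (x c * ∏ t x))}
           {λ c → ⟦ lo ≤? c ⟧ * above c} (λ c → begin
           ∑tuples k N (λ t → (⟦ lo ≤? c ⟧ * ascending (suc c) t) * (x c * ∏ t x))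
             ≈⟨ ∑tuples-cong k N (λ t → interchange _ _ _ _) ⟩
           ∑tuples k N (λ t → (⟦ lo ≤? c ⟧ * x c) * (ascending (suc c) t * ∏ t x))
             ≈⟨ *-∑tuples k N _ (λ t → ascending (suc c) t * ∏ t x) ⟨
           (⟦ lo ≤? c ⟧ * x c) * ∑tuples k N (λ t → ascending (suc c) t * ∏ t x)
             ≈⟨ *-congˡ (∑tuples-ascending k N (suc c) x) ⟩
           (⟦ lo ≤? c ⟧ * x c) * elementary k (N ∸ suc c) (λ i → x (suc c + i))
             ≈⟨ *-assoc _ _ _ ⟩
           ⟦ lo ≤? c ⟧ * above c ∎) ⟩
    ∑< N (λ c → ⟦ lo ≤? c ⟧ * above c)
      ≈⟨ ∑<-from N lo above ⟩
    ∑< (N ∸ lo) (λ s → above (lo + s))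
      ≈⟨ Σ.big<-cong (N ∸ lo) {λ s → above (lo + s)}
           {λ s → x (lo + s) * elementary k (N ∸ lo ∸ suc s) (λ i → x (lo + (suc s + i)))}
           (λ s → *-congˡ (trans
             (elementary-cong k (N ∸ suc (lo + s)) (λ i → reflexive (≡.cong x (shift s i))))
             (reflexive (≡.cong (λ M → elementary k M (λ i → x (lo + (suc s + i)))) (rest s))))) ⟩
    ∑< (N ∸ lo) (λ s → x (lo + s) * elementary k (N ∸ lo ∸ suc s) (λ i → x (lo + (suc s + i))))
      ≈⟨ elementary-first k (N ∸ lo) (λ i → x (lo + i)) ⟨
    elementary (suc k) (N ∸ lo) (λ i → x (lo + i)) ∎
    where
    open import Algebra.Properties.CommutativeSemigroup *-commutativeSemigroup using (interchange)

    above : ℕ → Carrier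
    above c = x c * elementary k (N ∸ suc c) (λ i → x (suc c + i))

    shift : ∀ s i → suc (lo + s) + i ≡ lo + (suc s + i)
    shift s i = ≡.trans (≡.cong (_+ i) (≡.sym (ℕ.+-suc lo s))) (ℕ.+-assoc lo (suc s) i)

    rest : ∀ s → N ∸ suc (lo + s) ≡ N ∸ lo ∸ suc s
    rest s = ≡.trans (≡.cong (N ∸_) (≡.sym (ℕ.+-suc lo s))) (≡.sym (ℕ.∸-+-assoc N lo (suc s)))

  ∑-linked : ∀ k N (x : ℕ → Carrier) →
    ∑ (filter (Linked.linked? _<?_) (tuples k N)) (λ i → ∏ (toList i) x) ≈ elementary k N x
  ∑-linked k N x = begin
    ∑ (filter (Linked.linked? _<?_) (tuples k N)) (λ i → ∏ (toList i) x)
      ≈⟨ ∑-filter (Linked.linked? _<?_) (tuples k N) (λ i → ∏ (toList i) x) ⟩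
    ∑ (tuples k N) (λ i → ⟦ Linked.linked? _<?_ i ⟧ * ∏ (toList i) x)
      ≈⟨ Σ.big-cong (tuples k N) (λ i → *-congʳ (⟦linked⟧ i)) ⟩
    ∑ (tuples k N) (λ i → ascending 0 (toList i) * ∏ (toList i) x)
      ≈⟨ ∑-tuples k N (λ t → ascending 0 t * ∏ t x) ⟩
    ∑tuples k N (λ t → ascending 0 t * ∏ t x)
      ≈⟨ ∑tuples-ascending k N 0 x ⟩
    elementary k N x ∎

  -- Proper colourings of two glued cycles

  nth : List ℕ → ℕ → ℕ
  nth []      _       = 0
  nth (c ∷ _) zero    = c
  nth (_ ∷ t) (suc i) = nth t i

  nth-lookup : ∀ {k} (κ : Vec ℕ k) i → nth (toList κ) (toℕ i) ≡ lookup κ i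
  nth-lookup (c Vec.∷ κ) zero    = ≡.refl
  nth-lookup (c Vec.∷ κ) (suc i) = nth-lookup κ i

  nth-drop : ∀ n t i → nth (drop n t) i ≡ nth t (n + i)
  nth-drop zero    t       i = ≡.refl
  nth-drop (suc n) []      i = ≡.refl
  nth-drop (suc n) (_ ∷ t) i = nth-drop n t i

  pathWeight : ℕ → List ℕ → Carrier
  pathWeight n t = ∏< n (λ i → χ (nth t i) (nth t (suc i)))

  cycleWeight : ℕ → List ℕ → Carrier
  cycleWeight n t = pathWeight n t * χ (nth t n) (nth t 0)

  -- The edge weight `h` stays abstract because the cycle occurs twice, under two different
  -- embeddings into the glued graph.
  ∏-cycle : ∀ n (t : List ℕ) (h : Fin (suc n) × Fin (suc n) → Carrier) →
            (∀ i j → h (i , j) ≈ χ (nth t (toℕ i)) (nth t (toℕ j))) →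
            ∏ (C (suc n)) h ≈ cycleWeight n t
  ∏-cycle n t h h≈χ = begin
    ∏ (map step (allFin n) ++ [ fromℕ n , zero ]) h     ≈⟨ Π.big-++ (map step (allFin n)) [ fromℕ n , zero ] h ⟩
    ∏ (map step (allFin n)) h * (h (fromℕ n , zero) * 1#)
      ≈⟨ *-cong (reflexive (≡.trans (Π.big-map step (allFin n) h) (Π.big-tabulate id (h ∘ step)))) (*-identityʳ _) ⟩
    Πˢ.sum (h ∘ step) * h (fromℕ n , zero)
      ≈⟨ *-cong
           (Πˢ.sum-cong-≋ {n} (λ i → trans (h≈χ (inject₁ i) (suc i))
             (reflexive (≡.cong (λ k → χ (nth t k) (nth t (suc (toℕ i)))) (toℕ-inject₁ i)))))
           (trans (h≈χ (fromℕ n) zero) (reflexive (≡.cong (λ k → χ (nth t k) (nth t 0)) (toℕ-fromℕ n)))) ⟩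
    cycleWeight n t ∎
    where
    module Πˢ = Algebra.Properties.CommutativeMonoid.Sum *-commutativeMonoid
    step : Fin n → Fin (suc n) × Fin (suc n)
    step i = inject₁ i , suc i

  -- The common vertex has number `a`. It ends the first cycle and is the head of `drop a`, hence
  -- also vertex 0 of the second.
  ⟦proper⟧ : ∀ a b (κ : Vec ℕ (a + suc b)) →
    ⟦ proper? (C (suc a) ⊕ C (suc b)) κ ⟧ ≈ cycleWeight a (toList κ) * cycleWeight b (drop a (toList κ))
  ⟦proper⟧ a b κ = begin
    ⟦ proper? (C (suc a) ⊕ C (suc b)) κ ⟧
      ≈⟨ ⟦⟧-all (λ (u , v) → ¬? (lookup κ u ≟ lookup κ v)) (C (suc a) ⊕ C (suc b)) ⟩
    ∏ (map (Product.map left left) (C (suc a)) ++ map (Product.map right right) (C (suc b))) edge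
      ≈⟨ Π.big-++ (map (Product.map left left) (C (suc a))) (map (Product.map right right) (C (suc b))) edge ⟩
    ∏ (map (Product.map left left) (C (suc a))) edge * ∏ (map (Product.map right right) (C (suc b))) edge
      ≡⟨ ≡.cong₂ _*_ (Π.big-map (Product.map left left) (C (suc a)) edge)
                     (Π.big-map (Product.map right right) (C (suc b)) edge) ⟩
    ∏ (C (suc a)) (edge ∘ Product.map left left) * ∏ (C (suc b)) (edge ∘ Product.map right right)
      ≈⟨ *-cong
           (∏-cycle a (toList κ) (edge ∘ Product.map left left)
             (λ i j → reflexive (≡.cong₂ χ (lookup-left i) (lookup-left j))))
           (∏-cycle b (drop a (toList κ)) (edge ∘ Product.map right right)
             (λ i j → reflexive (≡.cong₂ χ (lookup-right i) (lookup-right j)))) ⟩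
    cycleWeight a (toList κ) * cycleWeight b (drop a (toList κ)) ∎
    where
    edge : Fin (a + suc b) × Fin (a + suc b) → Carrier
    edge (u , v) = χ (lookup κ u) (lookup κ v)

    left : Fin (suc a) → Fin (a + suc b)
    left i = cast (≡.sym (ℕ.+-suc a b)) (i ↑ˡ b)

    right : Fin (suc b) → Fin (a + suc b)
    right j = a ↑ʳ j

    lookup-left : ∀ i → lookup κ (left i) ≡ nth (toList κ) (toℕ i)
    lookup-left i = ≡.trans (≡.sym (nth-lookup κ (left i)))
      (≡.cong (nth (toList κ)) (≡.trans (toℕ-cast _ (i ↑ˡ b)) (toℕ-↑ˡ i b)))

    lookup-right : ∀ j → lookup κ (right j) ≡ nth (drop a (toList κ)) (toℕ j)
    lookup-right j = ≡.trans (≡.sym (nth-lookup κ (right j)))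
      (≡.trans (≡.cong (nth (toList κ)) (toℕ-↑ʳ a j)) (≡.sym (nth-drop a (toList κ) (toℕ j))))

  -- Walks of colours and the transfer matrix

  module Walks (N : ℕ) (x : ℕ → Carrier) where

    step : (ℕ → Carrier) → (ℕ → Carrier)
    step φ c = ∑< N (λ i → mask c x i * φ i)

    steps : ℕ → (ℕ → Carrier) → (ℕ → Carrier)
    steps zero    φ = φ
    steps (suc n) φ = step (steps n φ)

    -- The sum over all proper walks of n steps that start at c and end at some
    -- f ≠ d, the vertex c not being counted in the monomial of the walk.
    W : ℕ → ℕ → ℕ → Carrier
    W n c d = steps n (λ f → χ f d) c

    step-cong : ∀ {φ ψ : ℕ → Carrier} → (∀ i → φ i ≈ ψ i) → ∀ c → step φ c ≈ step ψ c
    step-cong {φ} {ψ} φ≈ψ c =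
      Σ.big<-cong N {λ i → mask c x i * φ i} {λ i → mask c x i * ψ i} (λ i → *-congˡ (φ≈ψ i))

    steps-cong : ∀ n {φ ψ : ℕ → Carrier} → (∀ i → φ i ≈ ψ i) → ∀ c → steps n φ c ≈ steps n ψ c
    steps-cong zero    φ≈ψ = φ≈ψ
    steps-cong (suc n) φ≈ψ = step-cong (steps-cong n φ≈ψ)

    -- The first `n` entries of the tuple are walked through; `Ψ` receives the end of the walk with
    -- the `m` entries that are left. It can therefore carry a closing condition as well as a whole
    -- second cycle attached at that end.
    ∑tuples-path : ∀ n m (Ψ : List ℕ → Carrier) c →
      ∑tuples (n + m) N (λ t → (pathWeight n (c ∷ t) * ∏ t x) * Ψ (drop n (c ∷ t)))
        ≈ steps n (λ d → ∑tuples m N (λ s → ∏ s x * Ψ (d ∷ s))) c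
    ∑tuples-path zero    m Ψ c = ∑tuples-cong m N (λ t → *-congʳ (*-identityˡ _))
    ∑tuples-path (suc n) m Ψ c = Σ.big<-cong N
      {λ d → ∑tuples (n + m) N (λ t → (pathWeight (suc n) (c ∷ d ∷ t) * ∏ (d ∷ t) x) * Ψ (drop n (d ∷ t)))}
      {λ d → mask c x d * steps n (λ e → ∑tuples m N (λ s → ∏ s x * Ψ (e ∷ s))) d}
      (λ d → begin
        ∑tuples (n + m) N (λ t → ((χ c d * pathWeight n (d ∷ t)) * (x d * ∏ t x)) * Ψ (drop n (d ∷ t)))
          ≈⟨ ∑tuples-cong (n + m) N (λ t → trans (*-congʳ (interchange _ _ _ _)) (*-assoc _ _ _)) ⟩
        ∑tuples (n + m) N (λ t → mask c x d * ((pathWeight n (d ∷ t) * ∏ t x) * Ψ (drop n (d ∷ t))))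
          ≈⟨ *-∑tuples (n + m) N (mask c x d) (λ t → (pathWeight n (d ∷ t) * ∏ t x) * Ψ (drop n (d ∷ t))) ⟨
        mask c x d * ∑tuples (n + m) N (λ t → (pathWeight n (d ∷ t) * ∏ t x) * Ψ (drop n (d ∷ t)))
          ≈⟨ *-congˡ (∑tuples-path n m Ψ d) ⟩
        mask c x d * steps n (λ e → ∑tuples m N (λ s → ∏ s x * Ψ (e ∷ s))) d ∎)
      where open import Algebra.Properties.CommutativeSemigroup *-commutativeSemigroup using (interchange)

    ∑tuples-cycle : ∀ b d → ∑tuples b N (λ s → ∏ s x * cycleWeight b (d ∷ s)) ≈ W b d d
    ∑tuples-cycle b d = begin
      ∑tuples b N (λ s → ∏ s x * cycleWeight b (d ∷ s))
        ≈⟨ ∑tuples-cong b N (λ s → trans (sym (*-assoc _ _ _)) (*-cong (*-comm _ _)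
             (reflexive (≡.cong (λ f → χ f d)
               (≡.trans (≡.cong (nth (d ∷ s)) (≡.sym (ℕ.+-identityʳ b))) (≡.sym (nth-drop b (d ∷ s) 0))))))) ⟩
      ∑tuples b N (λ s → (pathWeight b (d ∷ s) * ∏ s x) * χ (nth (drop b (d ∷ s)) 0) d)
        -- Nothing follows the second cycle, so the path lemma is used with m = 0.
        ≡⟨ ≡.cong (λ k → ∑tuples k N (λ s → (pathWeight b (d ∷ s) * ∏ s x) * χ (nth (drop b (d ∷ s)) 0) d))
             (≡.sym (ℕ.+-identityʳ b)) ⟩
      ∑tuples (b + 0) N (λ s → (pathWeight b (d ∷ s) * ∏ s x) * χ (nth (drop b (d ∷ s)) 0) d)
        ≈⟨ ∑tuples-path b 0 (λ t → χ (nth t 0) d) d ⟩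
      steps b (λ f → 1# * χ f d) d
        ≈⟨ steps-cong b (λ f → *-identityˡ _) d ⟩
      W b d d ∎

    -- The last vertex `d` of the walk is split off. What precedes it ends at a colour other than
    -- `d`, which is the condition built into `W`.
    steps-expand : ∀ n (φ : ℕ → Carrier) c → steps (suc n) φ c ≈ ∑< N (λ d → φ d * (x d * W n c d))
    steps-expand zero φ c = Σ.big<-cong N {λ i → mask c x i * φ i} {λ i → φ i * (x i * χ c i)}
      (λ i → trans (*-comm _ _) (*-congˡ (*-comm _ _)))
    steps-expand (suc n) φ c = begin
      ∑< N (λ i → mask c x i * steps (suc n) φ i)
        ≈⟨ Σ.big<-cong N {λ i → mask c x i * steps (suc n) φ i} {λ i → ∑< N (term i)}
             (λ i → trans (*-congˡ (steps-expand n φ i))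
                          (*-∑<ˡ N (mask c x i) (λ d → φ d * (x d * W n i d)))) ⟩
      ∑< N (λ i → ∑< N (λ d → term i d))
        ≈⟨ Σ.big<-comm N N term ⟩
      ∑< N (λ d → ∑< N (λ i → term i d))
        ≈⟨ Σ.big<-cong N {λ d → ∑< N (λ i → term i d)} {λ d → φ d * (x d * W (suc n) c d)} (λ d → begin
             ∑< N (λ i → term i d)
               ≈⟨ Σ.big<-cong N {λ i → term i d} {λ i → (φ d * x d) * (mask c x i * W n i d)}
                    (λ i → solve 4 (λ m p y w → m :* (p :* (y :* w)) := (p :* y) :* (m :* w)) refl _ _ _ _) ⟩
             ∑< N (λ i → (φ d * x d) * (mask c x i * W n i d))
               ≈⟨ *-∑<ˡ N (φ d * x d) (λ i → mask c x i * W n i d) ⟨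
             (φ d * x d) * W (suc n) c d
               ≈⟨ *-assoc _ _ _ ⟩
             φ d * (x d * W (suc n) c d) ∎) ⟩
      ∑< N (λ d → φ d * (x d * W (suc n) c d)) ∎
      where
      term : ℕ → ℕ → Carrier
      term i d = mask c x i * (φ d * (x d * W n i d))

    -- The tuple starts at vertex 0 of the first cycle, but the second cycle is attached at the
    -- other end of the path. The first cycle is therefore rerooted: with the common colour `d`
    -- fixed, the closing edge becomes the first step from `d` to `c`, followed by `W a c d`, and
    -- summing over `c` gives `W (suc a) d d`. This needs at least one step, hence at least two
    -- vertices in the first cycle.
    ∑-proper : ∀ a b →
      ∑ (filter (proper? (C (suc (suc a)) ⊕ C (suc b))) (tuples (suc a + suc b) N)) (λ κ → ∏ (toList κ) x)
        ≈ ∑< N (λ d → x d * (W (suc a) d d * W b d d))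
    ∑-proper a b = begin
      ∑ (filter (proper? G) (tuples k N)) (λ κ → ∏ (toList κ) x)
        ≈⟨ ∑-filter (proper? G) (tuples k N) (λ κ → ∏ (toList κ) x) ⟩
      ∑ (tuples k N) (λ κ → ⟦ proper? G κ ⟧ * ∏ (toList κ) x)
        ≈⟨ Σ.big-cong (tuples k N) (λ κ → *-congʳ (⟦proper⟧ (suc a) b κ)) ⟩
      ∑ (tuples k N) (F ∘ toList)
        ≈⟨ ∑-tuples k N F ⟩
      ∑tuples k N F
        ≡⟨ ≡.cong (λ l → ∑tuples l N F) (ℕ.+-suc (suc a) b) ⟩
      ∑< N (λ c → ∑tuples (suc a + b) N (λ t → F (c ∷ t)))
        ≈⟨ Σ.big<-cong N {λ c → ∑tuples (suc a + b) N (λ t → F (c ∷ t))} {λ c → ∑< N (term c)} fromRoot ⟩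
      ∑< N (λ c → ∑< N (λ d → term c d))
        ≈⟨ Σ.big<-comm N N term ⟩
      ∑< N (λ d → ∑< N (λ c → term c d))
        ≈⟨ Σ.big<-cong N {λ d → ∑< N (λ c → term c d)} {λ d → x d * (W (suc a) d d * W b d d)} (λ d → begin
             ∑< N (λ c → term c d)
               ≈⟨ *-∑<ˡ N (x d * W b d d) (λ c → mask d x c * W a c d) ⟨
             (x d * W b d d) * W (suc a) d d
               ≈⟨ solve 3 (λ y v w → (y :* v) :* w := y :* (w :* v)) refl _ _ _ ⟩
             x d * (W (suc a) d d * W b d d) ∎) ⟩
      ∑< N (λ d → x d * (W (suc a) d d * W b d d)) ∎
      where
      k = suc a + suc b
      G = C (suc (suc a)) ⊕ C (suc b)

      F : List ℕ → Carrier
      F t = (cycleWeight (suc a) t * cycleWeight b (drop (suc a) t)) * ∏ t x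

      Ψ : ℕ → List ℕ → Carrier
      Ψ c s = χ (nth s 0) c * cycleWeight b s

      term : ℕ → ℕ → Carrier
      term c d = (x d * W b d d) * (mask d x c * W a c d)

      fromRoot : ∀ c → ∑tuples (suc a + b) N (λ t → F (c ∷ t)) ≈ ∑< N (term c)
      fromRoot c = begin
        ∑tuples (suc a + b) N (λ t → F (c ∷ t))
          ≈⟨ ∑tuples-cong (suc a + b) N (λ t → trans
               (*-congʳ (*-congʳ (*-congˡ (reflexive (≡.cong (λ f → χ f c)
                 (≡.trans (≡.cong (nth (c ∷ t)) (≡.sym (ℕ.+-identityʳ (suc a)))) (≡.sym (nth-drop (suc a) (c ∷ t) 0))))))))
               (solve 5 (λ p q r y m → ((p :* q) :* r) :* (y :* m) := y :* ((p :* m) :* (q :* r))) refl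
                 (pathWeight (suc a) (c ∷ t)) (χ (nth (drop (suc a) (c ∷ t)) 0) c)
                 (cycleWeight b (drop (suc a) (c ∷ t))) (x c) (∏ t x))) ⟩
        ∑tuples (suc a + b) N (λ t → x c * ((pathWeight (suc a) (c ∷ t) * ∏ t x) * Ψ c (drop (suc a) (c ∷ t))))
          ≈⟨ *-∑tuples (suc a + b) N (x c) (λ t → (pathWeight (suc a) (c ∷ t) * ∏ t x) * Ψ c (drop (suc a) (c ∷ t))) ⟨
        x c * ∑tuples (suc a + b) N (λ t → (pathWeight (suc a) (c ∷ t) * ∏ t x) * Ψ c (drop (suc a) (c ∷ t)))
          ≈⟨ *-congˡ (∑tuples-path (suc a) b (Ψ c) c) ⟩
        x c * steps (suc a) (λ d → ∑tuples b N (λ s → ∏ s x * Ψ c (d ∷ s))) c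
          ≈⟨ *-congˡ (steps-cong (suc a) closeSecond c) ⟩
        x c * steps (suc a) (λ d → χ d c * W b d d) c
          ≈⟨ *-congˡ (steps-expand a (λ d → χ d c * W b d d) c) ⟩
        x c * ∑< N (λ d → (χ d c * W b d d) * (x d * W a c d))
          ≈⟨ *-∑<ˡ N (x c) (λ d → (χ d c * W b d d) * (x d * W a c d)) ⟩
        ∑< N (λ d → x c * ((χ d c * W b d d) * (x d * W a c d)))
          ≈⟨ Σ.big<-cong N {λ d → x c * ((χ d c * W b d d) * (x d * W a c d))} {term c}
               (λ d → solve 5 (λ y p v z w → y :* ((p :* v) :* (z :* w)) := (z :* v) :* ((p :* y) :* w)) refl _ _ _ _ _) ⟩
        ∑< N (λ d → term c d) ∎
        where
        closeSecond : ∀ d → ∑tuples b N (λ s → ∏ s x * Ψ c (d ∷ s)) ≈ χ d c * W b d d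
        closeSecond d = begin
          ∑tuples b N (λ s → ∏ s x * (χ d c * cycleWeight b (d ∷ s)))
            ≈⟨ ∑tuples-cong b N (λ s → x∙yz≈y∙xz _ _ _) ⟩
          ∑tuples b N (λ s → χ d c * (∏ s x * cycleWeight b (d ∷ s)))
            ≈⟨ *-∑tuples b N (χ d c) (λ s → ∏ s x * cycleWeight b (d ∷ s)) ⟨
          χ d c * ∑tuples b N (λ s → ∏ s x * cycleWeight b (d ∷ s))
            ≈⟨ *-congˡ (∑tuples-cycle b d) ⟩
          χ d c * W b d d ∎
          where open import Algebra.Properties.CommutativeSemigroup *-commutativeSemigroup using (x∙yz≈y∙xz)

-- The expansion in elementary symmetric polynomials

module Expansion (R : CommutativeRing 0ℓ 0ℓ) (ι : ℤ → CommutativeRing.Carrier R)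
                 (ι-homo : IsRingHomomorphism ℤ.+-*-rawRing (CommutativeRing.rawRing R) ι) where
  open CommutativeRing R hiding (zero) renaming (_+_ to _+ᴿ_; _-_ to _-ᴿ_; -_ to -ᴿ_)
  open IsRingHomomorphism ι-homo using () renaming (+-homo to ι-+; *-homo to ι-*; 0#-homo to ι-0; 1#-homo to ι-1)
  open import Algebra.Properties.Group +-group using () renaming (∙-cancelˡ to +-cancelˡ; ∙-cancelʳ to +-cancelʳ)
  open import Algebra.Properties.CommutativeSemigroup *-commutativeSemigroup using (interchange)
  open import Algebra.Solver.Ring.NaturalCoefficients.Default commutativeSemiring using (solve; _:=_; _:+_; _:*_; con)
  open import Relation.Binary.Reasoning.Setoid setoid
  open Weights R

  ι-suc : ∀ n → ι (+ suc n) ≈ 1# +ᴿ ι (+ n)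
  ι-suc n = trans (ι-+ (+ 1) (+ n)) (+-congʳ ι-1)

  -- Each monomial of degree `suc k` arises once for every choice of a marked variable in it.
  ∑-mask-elementary : ∀ k N y →
    ∑< N (λ c → y c * elementary k N (mask c y)) ≈ ι (+ suc k) * elementary (suc k) N y
  ∑-mask-elementary k zero    y = sym (zeroʳ _)
  ∑-mask-elementary k (suc N) y = begin
    y 0 * elementary k (suc N) (mask 0 y) +ᴿ ∑< N (λ c → y (suc c) * elementary k (suc N) (mask (suc c) y))
      ≈⟨ +-congʳ (*-congˡ (mask-zero k N y)) ⟩
    y 0 * elementary k N (y ∘ suc) +ᴿ ∑< N (λ c → y (suc c) * elementary k (suc N) (mask (suc c) y))
      ≈⟨ go k ⟩
    ι (+ suc k) * (elementary (suc k) N (y ∘ suc) +ᴿ y 0 * elementary k N (y ∘ suc)) ∎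
    where
    -- The split on `k` lets `elementary k (suc N)` unfold. For positive `k` the induction on `N` is
    -- used in two degrees, according to whether the variable 0 is absent or present.
    go : ∀ k → y 0 * elementary k N (y ∘ suc) +ᴿ ∑< N (λ c → y (suc c) * elementary k (suc N) (mask (suc c) y))
                 ≈ ι (+ suc k) * (elementary (suc k) N (y ∘ suc) +ᴿ y 0 * elementary k N (y ∘ suc))
    go zero = begin
      y 0 * 1# +ᴿ ∑< N (λ c → y (suc c) * 1#)
        ≈⟨ +-congˡ (∑-mask-elementary 0 N (y ∘ suc)) ⟩
      y 0 * 1# +ᴿ ι (+ 1) * elementary 1 N (y ∘ suc)
        ≈⟨ +-congˡ (*-congʳ ι-1) ⟩
      y 0 * 1# +ᴿ 1# * elementary 1 N (y ∘ suc)
        ≈⟨ solve 2 (λ a e → a :* con 1 :+ con 1 :* e := con 1 :* (e :+ a :* con 1)) refl _ _ ⟩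
      1# * (elementary 1 N (y ∘ suc) +ᴿ y 0 * 1#)
        ≈⟨ *-congʳ ι-1 ⟨
      ι (+ 1) * (elementary 1 N (y ∘ suc) +ᴿ y 0 * 1#) ∎
    go (suc k) = begin
      y 0 * e₁ +ᴿ ∑< N (λ c → τ c * (f₁ c +ᴿ (1# * y 0) * f₀ c))
        ≈⟨ +-congˡ (Σ.big<-cong N {λ c → τ c * (f₁ c +ᴿ (1# * y 0) * f₀ c)} {λ c → τ c * f₁ c +ᴿ y 0 * (τ c * f₀ c)}
             (λ c → solve 4 (λ t a b y → t :* (a :+ (con 1 :* y) :* b) := t :* a :+ y :* (t :* b)) refl _ _ _ _)) ⟩
      y 0 * e₁ +ᴿ ∑< N (λ c → τ c * f₁ c +ᴿ y 0 * (τ c * f₀ c))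
        ≈⟨ +-congˡ (Σ.big<-∙ N (λ c → τ c * f₁ c) (λ c → y 0 * (τ c * f₀ c))) ⟩
      y 0 * e₁ +ᴿ (∑< N (λ c → τ c * f₁ c) +ᴿ ∑< N (λ c → y 0 * (τ c * f₀ c)))
        ≈⟨ +-congˡ (+-cong (∑-mask-elementary (suc k) N τ)
             (trans (sym (*-∑<ˡ N (y 0) (λ c → τ c * f₀ c))) (*-congˡ (∑-mask-elementary k N τ)))) ⟩
      y 0 * e₁ +ᴿ (ι (+ suc (suc k)) * e₂ +ᴿ y 0 * (ι (+ suc k) * e₁))
        ≈⟨ +-congˡ (+-congʳ (*-congʳ (ι-suc (suc k)))) ⟩
      y 0 * e₁ +ᴿ ((1# +ᴿ ι (+ suc k)) * e₂ +ᴿ y 0 * (ι (+ suc k) * e₁))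
        ≈⟨ solve 4 (λ y a b n → y :* a :+ ((con 1 :+ n) :* b :+ y :* (n :* a)) := (con 1 :+ n) :* (b :+ y :* a)) refl
             (y 0) e₁ e₂ (ι (+ suc k)) ⟩
      (1# +ᴿ ι (+ suc k)) * (e₂ +ᴿ y 0 * e₁)
        ≈⟨ *-congʳ (ι-suc (suc k)) ⟨
      ι (+ suc (suc k)) * (e₂ +ᴿ y 0 * e₁) ∎
      where
      τ = y ∘ suc
      e₁ = elementary (suc k) N τ
      e₂ = elementary (suc (suc k)) N τ
      f₀ f₁ : ℕ → Carrier
      f₀ c = elementary k N (mask c τ)
      f₁ c = elementary (suc k) N (mask c τ)

  -- Walk weights in elementary polynomials

  module _ (N : ℕ) (x : ℕ → Carrier) where
    open Walks N x

    e : ℕ → Carrier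
    e k = elementary k N x

    e∖ : ℕ → ℕ → Carrier
    e∖ d k = elementary k N (mask d x)

    term : List ℕ → Carrier
    term α = ι ∏[ α -1] * ∏ α e

    h : ℕ → Carrier
    h n = ∑ (compositions n) term

    term-∷ : ∀ i γ → term (suc i ∷ γ) ≈ (ι (+ i) * e (suc i)) * term γ
    term-∷ i γ = trans (*-congʳ (ι-* (+ i) ∏[ γ -1])) (interchange _ _ _ _)

    h-zero : h 0 ≈ 1#
    h-zero = trans (+-identityʳ _) (trans (*-identityʳ _) ι-1)

    h-suc : ∀ n → h (suc n) ≈ ∑< (suc n) (λ i → (ι (+ i) * e (suc i)) * h (n ∸ i))
    h-suc n = trans (∑-compositions-suc n term)
      (Σ.big<-cong (suc n) {λ i → ∑ (compositions (n ∸ i)) (term ∘ (suc i ∷_))} {λ i → (ι (+ i) * e (suc i)) * h (n ∸ i)}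
        (λ i → trans (Σ.big-cong (compositions (n ∸ i)) (term-∷ i))
                     (sym (*-∑ˡ (ι (+ i) * e (suc i)) (compositions (n ∸ i)) term))))

    -- The coefficient of h_{n-i} in `W n c d`. Off the diagonal it is e_i in the variables other
    -- than `c` and `d`; on the diagonal, deleting `d` once and multiplying by `i` is what the
    -- numerator of the resolvent dictates.
    u : ℕ → ℕ → ℕ → Carrier
    u i c d = if does (c ≟ d) then ι (+ i) * e∖ d i else elementary i N (mask c (mask d x))

    u-diagonal : ∀ i d → u i d d ≈ ι (+ i) * e∖ d i
    u-diagonal i d = reflexive (≡.cong (if_then ι (+ i) * e∖ d i else elementary i N (mask d (mask d x))) (dec-true (d ≟ d) ≡.refl))

    u-off-diagonal : ∀ i {c d} → c ≢ d → u i c d ≈ elementary i N (mask c (mask d x))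
    u-off-diagonal i {c} {d} c≢d = reflexive (≡.cong (if_then ι (+ i) * e∖ d i else elementary i N (mask c (mask d x))) (dec-false (c ≟ d) c≢d))

    -- The exceptional diagonal value of `u` is harmless here, since the mask vanishes at c = d.
    mask-u : ∀ i d c → mask d x c * u i c d ≈ mask d x c * elementary i N (mask c (mask d x))
    mask-u i d c = helper (d ≟ c)
      where
      helper : Dec (d ≡ c) → mask d x c * u i c d ≈ mask d x c * elementary i N (mask c (mask d x))
      helper (yes ≡.refl) = trans (vanish _) (sym (vanish _))
        where
        vanish : ∀ a → mask d x d * a ≈ 0#
        vanish a = trans (*-congʳ (trans (*-congʳ (χ-refl d)) (zeroˡ _))) (zeroˡ _)
      helper (no d≢c) = *-congˡ (u-off-diagonal i (≡.≢-sym d≢c))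

    ∑-mask-u : ∀ i d → ∑< N (λ c → mask d x c * u i c d) ≈ ι (+ suc i) * e∖ d (suc i)
    ∑-mask-u i d = trans
      (Σ.big<-cong N {λ c → mask d x c * u i c d} {λ c → mask d x c * elementary i N (mask c (mask d x))} (mask-u i d))
      (∑-mask-elementary i N (mask d x))

    -- The diagonal term carries the factor i and the remaining terms sum to i + 1 copies of e_{i+1}
    -- without `d`. So i of these copies combine with the diagonal term into the full e_{i+1}, and
    -- one is left.
    ∑-u : ∀ i {d} → d < N → ∑< N (λ c → x c * u i c d) ≈ ι (+ i) * e (suc i) +ᴿ e∖ d (suc i)
    ∑-u i {d} d<N = begin
      ∑< N (λ c → x c * u i c d)
        ≈⟨ ∑<-remove (λ c → x c * u i c d) d<N ⟩
      x d * u i d d +ᴿ ∑< N (λ c → χ d c * (x c * u i c d))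
        ≈⟨ +-cong (*-congˡ (u-diagonal i d))
             (trans (Σ.big<-cong N {λ c → χ d c * (x c * u i c d)} {λ c → mask d x c * u i c d} (λ c → sym (*-assoc _ _ _)))
                    (∑-mask-u i d)) ⟩
      x d * (ι (+ i) * e∖ d i) +ᴿ ι (+ suc i) * e∖ d (suc i)
        ≈⟨ +-congˡ (*-congʳ (ι-suc i)) ⟩
      x d * (ι (+ i) * e∖ d i) +ᴿ (1# +ᴿ ι (+ i)) * e∖ d (suc i)
        ≈⟨ solve 4 (λ y n a b → y :* (n :* a) :+ (con 1 :+ n) :* b := n :* (b :+ y :* a) :+ b) refl _ _ _ _ ⟩
      ι (+ i) * (e∖ d (suc i) +ᴿ x d * e∖ d i) +ᴿ e∖ d (suc i)
        ≈⟨ +-congʳ (*-congˡ (elementary-remove i x d<N)) ⟨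
      ι (+ i) * e (suc i) +ᴿ e∖ d (suc i) ∎

    -- The sum is that of `∑-u` without the term at `c`. This missing term is `x c * E`, which is
    -- exactly the part of `e∖ d (suc i)` containing the variable `c`; it is added to both sides and
    -- cancelled.
    ∑-step-u : ∀ i {c d} → c < N → d < N → c ≢ d →
      ∑< N (λ c′ → mask c x c′ * u i c′ d) ≈ ι (+ i) * e (suc i) +ᴿ u (suc i) c d
    ∑-step-u i {c} {d} c<N d<N c≢d = +-cancelˡ (x c * E) _ _ (begin
      x c * E +ᴿ ∑< N (λ c′ → mask c x c′ * u i c′ d)
        ≈⟨ +-cong (*-congˡ (sym (u-off-diagonal i c≢d)))
             (Σ.big<-cong N {λ c′ → mask c x c′ * u i c′ d} {λ c′ → χ c c′ * (x c′ * u i c′ d)} (λ c′ → *-assoc _ _ _)) ⟩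
      x c * u i c d +ᴿ ∑< N (λ c′ → χ c c′ * (x c′ * u i c′ d))
        ≈⟨ ∑<-remove (λ c′ → x c′ * u i c′ d) c<N ⟨
      ∑< N (λ c′ → x c′ * u i c′ d)
        ≈⟨ ∑-u i d<N ⟩
      ι (+ i) * e (suc i) +ᴿ e∖ d (suc i)
        ≈⟨ +-congˡ (elementary-remove i (mask d x) c<N) ⟩
      ι (+ i) * e (suc i) +ᴿ (E′ +ᴿ mask d x c * E)
        ≈⟨ +-congˡ (+-congˡ (*-congʳ (trans (*-congʳ (χ-≢ (≡.≢-sym c≢d))) (*-identityˡ _)))) ⟩
      ι (+ i) * e (suc i) +ᴿ (E′ +ᴿ x c * E)
        ≈⟨ solve 3 (λ a b s → a :+ (b :+ s) := s :+ (a :+ b)) refl _ _ _ ⟩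
      x c * E +ᴿ (ι (+ i) * e (suc i) +ᴿ E′)
        ≈⟨ +-congˡ (+-congˡ (u-off-diagonal (suc i) c≢d)) ⟨
      x c * E +ᴿ (ι (+ i) * e (suc i) +ᴿ u (suc i) c d) ∎)
      where
      E  = elementary i N (mask c (mask d x))
      E′ = elementary (suc i) N (mask c (mask d x))

    -- A step sends u_i to u_{i+1}, and off the diagonal also produces i e_{i+1}. By `h-suc` these
    -- extra terms add up to h_{n+1}, the term with u_0 = 1. On the diagonal there are no extra
    -- terms, and u_0 = 0.
    W-expand : ∀ n {c d} → c < N → d < N → W n c d ≈ ∑< (suc n) (λ i → u i c d * h (n ∸ i))
    W-expand zero {c} {d} c<N d<N = sym (trans (+-identityʳ _) (trans (*-congˡ h-zero) (trans (*-identityʳ _) (u₀ (c ≟ d)))))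
      where
      u₀ : Dec (c ≡ d) → u 0 c d ≈ χ c d
      u₀ (yes ≡.refl) = trans (u-diagonal 0 d) (trans (*-congʳ ι-0) (trans (zeroˡ _) (sym (χ-refl d))))
      u₀ (no c≢d)     = trans (u-off-diagonal 0 c≢d) (sym (χ-≢ c≢d))
    W-expand (suc n) {c} {d} c<N d<N = begin
      ∑< N (λ c′ → mask c x c′ * W n c′ d)
        ≈⟨ Σ.big<-cong-< N {λ c′ → mask c x c′ * W n c′ d} {λ c′ → ∑< (suc n) (T c′)}
             (λ c′ c′<N → trans (*-congˡ (W-expand n c′<N d<N)) (*-∑<ˡ (suc n) (mask c x c′) (λ i → u i c′ d * h (n ∸ i)))) ⟩
      ∑< N (λ c′ → ∑< (suc n) (T c′))
        ≈⟨ Σ.big<-comm N (suc n) T ⟩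
      ∑< (suc n) (λ i → ∑< N (λ c′ → T c′ i))
        ≈⟨ Σ.big<-cong (suc n) {λ i → ∑< N (λ c′ → T c′ i)} {λ i → B i * h (n ∸ i)} (λ i → trans
             (Σ.big<-cong N {λ c′ → T c′ i} {λ c′ → (mask c x c′ * u i c′ d) * h (n ∸ i)} (λ c′ → sym (*-assoc _ _ _)))
             (sym (*-∑<ʳ N (h (n ∸ i)) (λ c′ → mask c x c′ * u i c′ d)))) ⟩
      ∑< (suc n) (λ i → B i * h (n ∸ i))
        ≈⟨ collect (c ≟ d) ⟩
      u 0 c d * h (suc n) +ᴿ ∑< (suc n) (λ i → u (suc i) c d * h (n ∸ i)) ∎
      where
      T : ℕ → ℕ → Carrier
      T c′ i = mask c x c′ * (u i c′ d * h (n ∸ i))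

      B : ℕ → Carrier
      B i = ∑< N (λ c′ → mask c x c′ * u i c′ d)

      collect : Dec (c ≡ d) → ∑< (suc n) (λ i → B i * h (n ∸ i))
                  ≈ u 0 c d * h (suc n) +ᴿ ∑< (suc n) (λ i → u (suc i) c d * h (n ∸ i))
      collect (yes ≡.refl) = begin
        ∑< (suc n) (λ i → B i * h (n ∸ i))
          ≈⟨ Σ.big<-cong (suc n) {λ i → B i * h (n ∸ i)} {λ i → u (suc i) d d * h (n ∸ i)}
               (λ i → *-congʳ (trans (∑-mask-u i d) (sym (u-diagonal (suc i) d)))) ⟩
        ∑< (suc n) (λ i → u (suc i) d d * h (n ∸ i))
          ≈⟨ +-identityˡ _ ⟨
        0# +ᴿ ∑< (suc n) (λ i → u (suc i) d d * h (n ∸ i))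
          ≈⟨ +-congʳ (trans (*-congʳ (trans (u-diagonal 0 d) (trans (*-congʳ ι-0) (zeroˡ _)))) (zeroˡ _)) ⟨
        u 0 d d * h (suc n) +ᴿ ∑< (suc n) (λ i → u (suc i) d d * h (n ∸ i)) ∎
      collect (no c≢d) = begin
        ∑< (suc n) (λ i → B i * h (n ∸ i))
          ≈⟨ Σ.big<-cong (suc n) {λ i → B i * h (n ∸ i)}
               {λ i → (ι (+ i) * e (suc i)) * h (n ∸ i) +ᴿ u (suc i) c d * h (n ∸ i)}
               (λ i → trans (*-congʳ (∑-step-u i c<N d<N c≢d)) (distribʳ _ _ _)) ⟩
        ∑< (suc n) (λ i → (ι (+ i) * e (suc i)) * h (n ∸ i) +ᴿ u (suc i) c d * h (n ∸ i))
          ≈⟨ Σ.big<-∙ (suc n) (λ i → (ι (+ i) * e (suc i)) * h (n ∸ i)) (λ i → u (suc i) c d * h (n ∸ i)) ⟩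
        ∑< (suc n) (λ i → (ι (+ i) * e (suc i)) * h (n ∸ i)) +ᴿ ∑< (suc n) (λ i → u (suc i) c d * h (n ∸ i))
          ≈⟨ +-congʳ (trans (sym (h-suc n)) (sym (trans (*-congʳ (u-off-diagonal 0 c≢d)) (*-identityˡ _)))) ⟩
        u 0 c d * h (suc n) +ᴿ ∑< (suc n) (λ i → u (suc i) c d * h (n ∸ i)) ∎

    -- Products of elementary polynomials with one variable deleted

    Q : ℕ → ℕ → Carrier
    Q i j = ∑< N (λ d → x d * (e∖ d i * e∖ d j))

    Q-comm : ∀ i j → Q i j ≈ Q j i
    Q-comm i j = Σ.big<-cong N {λ d → x d * (e∖ d i * e∖ d j)} {λ d → x d * (e∖ d j * e∖ d i)} (λ d → *-congˡ (*-comm _ _))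

    -- Marking a variable in the terms of e i produces the factor i; both sides then
    -- expand in the elementary polynomials without the marked variable.
    Q-exchange : ∀ i j → Q i (suc j) +ᴿ ι (+ suc j) * (e (suc i) * e (suc j))
                       ≈ Q (suc i) j +ᴿ ι (+ suc i) * (e (suc i) * e (suc j))
    Q-exchange i j = begin
      Q i (suc j) +ᴿ ι (+ suc j) * (e (suc i) * e (suc j))
        ≈⟨ +-congˡ (trans (*-congˡ (*-comm _ _)) (expand j i)) ⟩
      Q i (suc j) +ᴿ ∑< N (marked j i)
        ≈⟨ Σ.big<-∙ N (λ d → x d * (e∖ d i * e∖ d (suc j))) (marked j i) ⟨
      ∑< N (λ d → x d * (e∖ d i * e∖ d (suc j)) +ᴿ marked j i d)
        ≈⟨ Σ.big<-cong-< N {λ d → x d * (e∖ d i * e∖ d (suc j)) +ᴿ marked j i d}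
             {λ d → x d * (e∖ d (suc i) * e∖ d j) +ᴿ marked i j d} (λ d d<N → begin
             x d * (e∖ d i * e∖ d (suc j)) +ᴿ (x d * e∖ d j) * e (suc i)
               ≈⟨ +-congˡ (*-congˡ (elementary-remove i x d<N)) ⟩
             x d * (e∖ d i * e∖ d (suc j)) +ᴿ (x d * e∖ d j) * (e∖ d (suc i) +ᴿ x d * e∖ d i)
               ≈⟨ solve 5 (λ y a a′ b b′ → y :* (a :* b′) :+ (y :* b) :* (a′ :+ y :* a)
                             := y :* (a′ :* b) :+ (y :* a) :* (b′ :+ y :* b)) refl _ _ _ _ _ ⟩
             x d * (e∖ d (suc i) * e∖ d j) +ᴿ (x d * e∖ d i) * (e∖ d (suc j) +ᴿ x d * e∖ d j)
               ≈⟨ +-congˡ (*-congˡ (elementary-remove j x d<N)) ⟨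
             x d * (e∖ d (suc i) * e∖ d j) +ᴿ (x d * e∖ d i) * e (suc j) ∎) ⟩
      ∑< N (λ d → x d * (e∖ d (suc i) * e∖ d j) +ᴿ marked i j d)
        ≈⟨ Σ.big<-∙ N (λ d → x d * (e∖ d (suc i) * e∖ d j)) (marked i j) ⟩
      Q (suc i) j +ᴿ ∑< N (marked i j)
        ≈⟨ +-congˡ (expand i j) ⟨
      Q (suc i) j +ᴿ ι (+ suc i) * (e (suc i) * e (suc j)) ∎
      where
      marked : ℕ → ℕ → ℕ → Carrier
      marked i j d = (x d * e∖ d i) * e (suc j)

      expand : ∀ i j → ι (+ suc i) * (e (suc i) * e (suc j)) ≈ ∑< N (marked i j)
      expand i j = begin
        ι (+ suc i) * (e (suc i) * e (suc j))            ≈⟨ *-assoc _ _ _ ⟨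
        (ι (+ suc i) * e (suc i)) * e (suc j)            ≈⟨ *-congʳ (∑-mask-elementary i N x) ⟨
        ∑< N (λ d → x d * e∖ d i) * e (suc j)            ≈⟨ *-∑<ʳ N (e (suc j)) (λ d → x d * e∖ d i) ⟩
        ∑< N (marked i j)                                ∎

    Q-suc : ∀ i j → Q i (suc j) ≈ Q (suc i) j +ᴿ ι (+ i ℤ.- + j) * (e (suc i) * e (suc j))
    Q-suc i j = +-cancelʳ (ι (+ suc j) * ee) _ _ (begin
      Q i (suc j) +ᴿ ι (+ suc j) * ee                                   ≈⟨ Q-exchange i j ⟩
      Q (suc i) j +ᴿ ι (+ suc i) * ee
        ≈⟨ +-congˡ (*-congʳ (trans (reflexive (≡.cong ι (split (+ i) (+ j)))) (ι-+ (+ i ℤ.- + j) (+ suc j)))) ⟩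
      Q (suc i) j +ᴿ (ι (+ i ℤ.- + j) +ᴿ ι (+ suc j)) * ee
        ≈⟨ +-congˡ (distribʳ _ _ _) ⟩
      Q (suc i) j +ᴿ (ι (+ i ℤ.- + j) * ee +ᴿ ι (+ suc j) * ee)         ≈⟨ +-assoc _ _ _ ⟨
      (Q (suc i) j +ᴿ ι (+ i ℤ.- + j) * ee) +ᴿ ι (+ suc j) * ee         ∎)
      where
      ee = e (suc i) * e (suc j)
      split : ∀ i j → (+ 1) ℤ.+ i ≡ (i ℤ.- j) ℤ.+ ((+ 1) ℤ.+ j)
      split = solve-∀

    -- The summand depends on i and j only through s = i + j + 1, which the exchange relation
    -- preserves; iterating that relation therefore just appends summands.
    D : ℕ → ℕ → Carrier
    D s q = ι (+ s ℤ.- + (q + q)) * (e (s ∸ q) * e q)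

    -- The second index is lowered to 0, where Q_{i+j,0} is (i + j + 1) e_{i+j+1} by marking. The
    -- exchange from j + 1 to j contributes the summand q = j + 1.
    Q-closed : ∀ i j → Q i j ≈ ∑< (suc j) (D (suc (i + j)))
    Q-closed i zero = begin
      ∑< N (λ d → x d * (e∖ d i * 1#))
        ≈⟨ Σ.big<-cong N {λ d → x d * (e∖ d i * 1#)} {λ d → x d * e∖ d i} (λ d → *-congˡ (*-identityʳ _)) ⟩
      ∑< N (λ d → x d * e∖ d i)
        ≈⟨ ∑-mask-elementary i N x ⟩
      ι (+ suc i) * e (suc i)
        ≡⟨ ≡.cong₂ (λ z k → ι z * e k) (≡.sym (≡.trans (ℤ.+-identityʳ _) (≡.cong (+_ ∘ suc) (ℕ.+-identityʳ i))))
                                       (≡.cong suc (≡.sym (ℕ.+-identityʳ i))) ⟩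
      ι (+ suc (i + 0) ℤ.- + 0) * e (suc (i + 0))
        ≈⟨ trans (+-identityʳ _) (*-congˡ (*-identityʳ _)) ⟨
      ∑< 1 (D (suc (i + 0))) ∎
    Q-closed i (suc j) = begin
      Q i (suc j)
        ≈⟨ Q-suc i j ⟩
      Q (suc i) j +ᴿ ι (+ i ℤ.- + j) * (e (suc i) * e (suc j))
        ≈⟨ +-cong (Q-closed (suc i) j) (reflexive (≡.cong₂ (λ z k → ι z * (e k * e (suc j))) coeff index)) ⟩
      ∑< (suc j) (D (suc (suc i + j))) +ᴿ D (suc (suc i + j)) (suc j)
        ≈⟨ Σ.big<-last (suc j) (D (suc (suc i + j))) ⟨
      ∑< (suc (suc j)) (D (suc (suc i + j)))
        ≡⟨ ≡.cong (λ s → ∑< (suc (suc j)) (D (suc s))) (≡.sym (ℕ.+-suc i j)) ⟩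
      ∑< (suc (suc j)) (D (suc (i + suc j))) ∎
      where
      index : suc i ≡ suc (suc i + j) ∸ suc j
      index = ≡.sym (ℕ.m+n∸n≡m (suc i) j)

      coeff : + i ℤ.- + j ≡ + suc (suc i + j) ℤ.- + (suc j + suc j)
      coeff = lemma (+ i) (+ j)
        where
        lemma : ∀ i j → i ℤ.- j ≡ ((+ 1) ℤ.+ (((+ 1) ℤ.+ i) ℤ.+ j)) ℤ.- (((+ 1) ℤ.+ j) ℤ.+ ((+ 1) ℤ.+ j))
        lemma = solve-∀

    -- By symmetry of Q the sum may stop at the smaller index. The bound is stated in this lopsided
    -- form because q ≤ i is the condition β₁ ≤ α₁, whereas q ≤ j is α₁ ≤ β₂.
    Q-admissible : ∀ i j → Q i j ≈ ∑< (suc i) (λ q → ⟦ q ≤? j ⟧ * D (suc (i + j)) q)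
    Q-admissible i j with ℕ.≤-total i j
    ... | inj₁ i≤j = begin
      Q i j
        ≈⟨ trans (Q-comm i j) (Q-closed j i) ⟩
      ∑< (suc i) (D (suc (j + i)))
        ≡⟨ ≡.cong (λ s → ∑< (suc i) (D (suc s))) (ℕ.+-comm j i) ⟩
      ∑< (suc i) (D (suc (i + j)))
        ≈⟨ Σ.big<-cong-< (suc i) {D (suc (i + j))} {λ q → ⟦ q ≤? j ⟧ * D (suc (i + j)) q}
             (λ q q≤i → sym (trans (*-congʳ (⟦⟧-yes (q ≤? j) (ℕ.≤-trans (ℕ.≤-pred q≤i) i≤j))) (*-identityˡ _))) ⟩
      ∑< (suc i) (λ q → ⟦ q ≤? j ⟧ * D (suc (i + j)) q) ∎
    ... | inj₂ j≤i = begin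
      Q i j
        ≈⟨ Q-closed i j ⟩
      ∑< (suc j) (D (suc (i + j)))
        ≈⟨ ∑<-below (D (suc (i + j))) (s≤s j≤i) ⟨
      ∑< (suc i) (λ q → ⟦ suc q ≤? suc j ⟧ * D (suc (i + j)) q)
        ≈⟨ Σ.big<-cong (suc i) {λ q → ⟦ suc q ≤? suc j ⟧ * D (suc (i + j)) q} {λ q → ⟦ q ≤? j ⟧ * D (suc (i + j)) q}
             (λ q → *-congʳ (⟦⟧-⇔ (suc q ≤? suc j) (q ≤? j) (mk⇔ ℕ.≤-pred s≤s))) ⟩
      ∑< (suc i) (λ q → ⟦ q ≤? j ⟧ * D (suc (i + j)) q) ∎

    -- The sum over pairs of compositions

    summand : List ℕ → List ℕ → Carrier
    summand α β = ι (coefficient α β) * ∏ (parts α β) e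

    -- The contribution of the second cycle for fixed i; both sides of the theorem are reduced to
    -- the same sum of these.
    S : ℕ → ℕ → Carrier
    S b i = ∑< (suc b) (λ j → Q i j * (ι (+ j) * h (b ∸ j)))

    summand-∷∷ : ∀ i γ q p δ → summand (suc i ∷ γ) (suc q ∷ suc p ∷ δ) ≈
      (ι (+ i) * term γ)
        * ((ι ((+ suc p ℤ.- + suc q ℤ.+ + 1) ℤ.* (+ suc q ℤ.+ + suc p ℤ.- + suc i ℤ.- + 1)) * (e (suc p) * e q)) * term δ)
    summand-∷∷ i γ q p δ = begin
      ι (((+ i ℤ.* ∏[ γ -1]) ℤ.* k) ℤ.* ∏[ δ -1]) * ∏ (γ ++ ((suc p ∷ δ) ++ [ q ])) e
        ≈⟨ *-cong
             (trans (ι-* ((+ i ℤ.* ∏[ γ -1]) ℤ.* k) ∏[ δ -1])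
               (*-congʳ (trans (ι-* (+ i ℤ.* ∏[ γ -1]) k) (*-congʳ (ι-* (+ i) ∏[ γ -1])))))
             (trans (Π.big-++ γ ((suc p ∷ δ) ++ [ q ]) e) (*-congˡ (Π.big-++ (suc p ∷ δ) [ q ] e))) ⟩
      (((ι (+ i) * ι ∏[ γ -1]) * ι k) * ι ∏[ δ -1]) * (∏ γ e * ((e (suc p) * ∏ δ e) * (e q * 1#)))
        ≈⟨ solve 8 (λ i c k d a p b q → (((i :* c) :* k) :* d) :* (a :* ((p :* b) :* (q :* con 1)))
                      := (i :* (c :* a)) :* ((k :* (p :* q)) :* (d :* b))) refl _ _ _ _ _ _ _ _ ⟩
      (ι (+ i) * term γ) * ((ι k * (e (suc p) * e q)) * term δ) ∎
      where k = (+ suc p ℤ.- + suc q ℤ.+ + 1) ℤ.* (+ suc q ℤ.+ + suc p ℤ.- + suc i ℤ.- + 1)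

    -- The first two parts of β are summed separately, as q + 1 and p + 1, and all further parts
    -- collapse into one `h`. Replacing p by j = q + p - i and summing over q first reassembles
    -- Q_{i,j}.
    ∑-second : ∀ b i γ →
      ∑ (filter (admissible? (suc i ∷ γ)) (compositions (suc b + suc i))) (summand (suc i ∷ γ))
        ≈ (ι (+ i) * term γ) * S b i
    ∑-second b i γ = begin
      ∑ (filter (admissible? α) (compositions n)) (summand α)
        ≈⟨ ∑-filter (admissible? α) (compositions n) (summand α) ⟩
      ∑ (compositions n) g
        -- Tuples with fewer than two parts are not admissible and have weight zero. Below, the
        -- empty tail does occur, namely when β₁ exhausts n.
        ≈⟨ ∑-compositions-nonempty n g (zeroˡ _) ⟩
      ∑< n (λ q → ∑ (compositions (n ∸ suc q)) (g ∘ (suc q ∷_)))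
        ≈⟨ Σ.big<-cong n {λ q → ∑ (compositions (n ∸ suc q)) (g ∘ (suc q ∷_))} {λ q → ⟦ suc q ≤? suc i ⟧ * (A * inner q)}
             (λ q → trans
               (∑-compositions-nonempty (n ∸ suc q) (g ∘ (suc q ∷_)) (zeroˡ _))
               (trans
                 (Σ.big<-cong (n ∸ suc q)
                    {λ p → ∑ (compositions (n ∸ suc q ∸ suc p)) (λ δ → g (suc q ∷ suc p ∷ δ))}
                    {λ p → (⟦ suc q ≤? suc i ⟧ * A) * (⟦ suc i ≤? suc p ⟧ * (K q p * h (n ∸ suc q ∸ suc p)))}
                    (third q))
                 (trans
                   (sym (*-∑<ˡ (n ∸ suc q) (⟦ suc q ≤? suc i ⟧ * A)
                           (λ p → ⟦ suc i ≤? suc p ⟧ * (K q p * h (n ∸ suc q ∸ suc p)))))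
                   (*-assoc _ _ _)))) ⟩
      ∑< n (λ q → ⟦ suc q ≤? suc i ⟧ * (A * inner q))
        -- The condition β₁ ≤ α₁ shortens the range of q to q ≤ i.
        ≈⟨ ∑<-below (λ q → A * inner q) (ℕ.m≤n+m (suc i) (suc b)) ⟩
      ∑< (suc i) (λ q → A * inner q)
        ≈⟨ *-∑<ˡ (suc i) A inner ⟨
      A * ∑< (suc i) inner
        ≈⟨ *-congˡ (Σ.big<-cong (suc i) {inner} {λ q → ∑< (suc b) (λ j → cell q j)} reindex) ⟩
      A * ∑< (suc i) (λ q → ∑< (suc b) (λ j → cell q j))
        ≈⟨ *-congˡ (Σ.big<-comm (suc i) (suc b) cell) ⟩
      A * ∑< (suc b) (λ j → ∑< (suc i) (λ q → cell q j))
        ≈⟨ *-congˡ (Σ.big<-cong (suc b) {λ j → ∑< (suc i) (λ q → cell q j)} {λ j → Q i j * (ι (+ j) * h (b ∸ j))} (λ j → begin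
             ∑< (suc i) (λ q → cell q j)
               ≈⟨ Σ.big<-cong (suc i) {λ q → cell q j} {λ q → (⟦ q ≤? j ⟧ * D (suc (i + j)) q) * (ι (+ j) * h (b ∸ j))}
                    (λ q → sym (*-assoc _ _ _)) ⟩
             ∑< (suc i) (λ q → (⟦ q ≤? j ⟧ * D (suc (i + j)) q) * (ι (+ j) * h (b ∸ j)))
               ≈⟨ *-∑<ʳ (suc i) (ι (+ j) * h (b ∸ j)) (λ q → ⟦ q ≤? j ⟧ * D (suc (i + j)) q) ⟨
             ∑< (suc i) (λ q → ⟦ q ≤? j ⟧ * D (suc (i + j)) q) * (ι (+ j) * h (b ∸ j))
               ≈⟨ *-congʳ (Q-admissible i j) ⟨
             Q i j * (ι (+ j) * h (b ∸ j)) ∎)) ⟩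
      A * S b i ∎
      where
      α = suc i ∷ γ
      n = suc b + suc i
      A = ι (+ i) * term γ

      g : List ℕ → Carrier
      g β = ⟦ admissible? α β ⟧ * summand α β

      K : ℕ → ℕ → Carrier
      K q p = ι ((+ suc p ℤ.- + suc q ℤ.+ + 1) ℤ.* (+ suc q ℤ.+ + suc p ℤ.- + suc i ℤ.- + 1)) * (e (suc p) * e q)

      inner : ℕ → Carrier
      inner q = ∑< (n ∸ suc q) (λ p → ⟦ suc i ≤? suc p ⟧ * (K q p * h (n ∸ suc q ∸ suc p)))

      cell : ℕ → ℕ → Carrier
      cell q j = ⟦ q ≤? j ⟧ * (D (suc (i + j)) q * (ι (+ j) * h (b ∸ j)))

      third : ∀ q p → ∑ (compositions (n ∸ suc q ∸ suc p)) (λ δ → g (suc q ∷ suc p ∷ δ))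
                ≈ (⟦ suc q ≤? suc i ⟧ * A) * (⟦ suc i ≤? suc p ⟧ * (K q p * h (n ∸ suc q ∸ suc p)))
      third q p = begin
        ∑ (compositions m) (λ δ → g (suc q ∷ suc p ∷ δ))
          ≈⟨ Σ.big-cong (compositions m) (λ δ → begin
               g (suc q ∷ suc p ∷ δ)
                 ≈⟨ *-cong (⟦⟧-× (suc q ≤? suc i) (suc i ≤? suc p)) (summand-∷∷ i γ q p δ) ⟩
               (⟦ suc q ≤? suc i ⟧ * ⟦ suc i ≤? suc p ⟧) * (A * (K q p * term δ))
                 ≈⟨ solve 5 (λ u v a k t → (u :* v) :* (a :* (k :* t)) := ((u :* a) :* (v :* k)) :* t) refl _ _ _ _ _ ⟩
               ((⟦ suc q ≤? suc i ⟧ * A) * (⟦ suc i ≤? suc p ⟧ * K q p)) * term δ ∎) ⟩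
        ∑ (compositions m) (λ δ → ((⟦ suc q ≤? suc i ⟧ * A) * (⟦ suc i ≤? suc p ⟧ * K q p)) * term δ)
          ≈⟨ *-∑ˡ ((⟦ suc q ≤? suc i ⟧ * A) * (⟦ suc i ≤? suc p ⟧ * K q p)) (compositions m) term ⟨
        ((⟦ suc q ≤? suc i ⟧ * A) * (⟦ suc i ≤? suc p ⟧ * K q p)) * h m
          ≈⟨ trans (*-assoc _ _ _) (*-congˡ (*-assoc _ _ _)) ⟩
        (⟦ suc q ≤? suc i ⟧ * A) * (⟦ suc i ≤? suc p ⟧ * (K q p * h m)) ∎
        where m = n ∸ suc q ∸ suc p

      -- Taken at k = 0 this is the range of t = p - i, and at k = t + 1 the size left for the parts
      -- of β after the second.
      remaining : ∀ q k → n ∸ suc q ∸ (k + i) ≡ suc b ∸ (q + k)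
      remaining q k = ≡.trans (ℕ.∸-+-assoc (b + suc i) q (k + i))
        (≡.trans (≡.cong₂ _∸_ (≡.trans (ℕ.+-suc b i) (ℕ.+-comm (suc b) i))
                              (≡.trans (≡.sym (ℕ.+-assoc q k i)) (ℕ.+-comm (q + k) i)))
                 (ℕ.[m+n]∸[m+o]≡n∸o i (suc b) (q + k)))

      -- With j = q + t, the factor β₂ - β₁ + 1 becomes i + j + 1 - 2q, the coefficient in `D`, and
      -- β₁ + β₂ - α₁ - 1 becomes j, the weight of the second closed walk.
      K-shift : ∀ q t → K q (i + t) ≈ D (suc (i + (q + t))) q * ι (+ (q + t))
      K-shift q t = begin
        ι ((+ suc (i + t) ℤ.- + suc q ℤ.+ + 1) ℤ.* (+ suc q ℤ.+ + suc (i + t) ℤ.- + suc i ℤ.- + 1)) * (e (suc (i + t)) * e q)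
          ≡⟨ ≡.cong₂ (λ z k → ι z * (e k * e q)) (coeff (+ i) (+ q) (+ t)) index ⟩
        ι ((+ suc (i + (q + t)) ℤ.- + (q + q)) ℤ.* + (q + t)) * (e (suc (i + (q + t)) ∸ q) * e q)
          ≈⟨ *-congʳ (ι-* (+ suc (i + (q + t)) ℤ.- + (q + q)) (+ (q + t))) ⟩
        (ι (+ suc (i + (q + t)) ℤ.- + (q + q)) * ι (+ (q + t))) * (e (suc (i + (q + t)) ∸ q) * e q)
          ≈⟨ solve 3 (λ u v w → (u :* v) :* w := (u :* w) :* v) refl _ _ _ ⟩
        D (suc (i + (q + t))) q * ι (+ (q + t)) ∎
        where
        index : suc (i + t) ≡ suc (i + (q + t)) ∸ q
        index = ≡.sym (≡.trans (≡.cong (_∸ q) (x∙yz≈y∙xz (suc i) q t)) (ℕ.m+n∸m≡n q (suc i + t)))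
          where open import Algebra.Properties.CommutativeSemigroup ℕ.+-commutativeSemigroup using (x∙yz≈y∙xz)

        coeff : ∀ i q t →
          (((+ 1) ℤ.+ (i ℤ.+ t)) ℤ.- ((+ 1) ℤ.+ q) ℤ.+ (+ 1))
            ℤ.* (((+ 1) ℤ.+ q) ℤ.+ ((+ 1) ℤ.+ (i ℤ.+ t)) ℤ.- ((+ 1) ℤ.+ i) ℤ.- (+ 1))
          ≡ (((+ 1) ℤ.+ (i ℤ.+ (q ℤ.+ t))) ℤ.- (q ℤ.+ q)) ℤ.* (q ℤ.+ t)
        coeff = solve-∀

      reindex : ∀ q → inner q ≈ ∑< (suc b) (cell q)
      reindex q = begin
        ∑< (n ∸ suc q) (λ p → ⟦ suc i ≤? suc p ⟧ * (K q p * h (n ∸ suc q ∸ suc p)))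
          ≈⟨ Σ.big<-cong (n ∸ suc q)
               {λ p → ⟦ suc i ≤? suc p ⟧ * (K q p * h (n ∸ suc q ∸ suc p))}
               {λ p → ⟦ i ≤? p ⟧ * (K q p * h (n ∸ suc q ∸ suc p))}
               (λ p → *-congʳ (⟦⟧-⇔ (suc i ≤? suc p) (i ≤? p) (mk⇔ ℕ.≤-pred s≤s))) ⟩
        ∑< (n ∸ suc q) (λ p → ⟦ i ≤? p ⟧ * (K q p * h (n ∸ suc q ∸ suc p)))
          ≈⟨ ∑<-from (n ∸ suc q) i (λ p → K q p * h (n ∸ suc q ∸ suc p)) ⟩
        ∑< (n ∸ suc q ∸ i) (λ t → K q (i + t) * h (n ∸ suc q ∸ suc (i + t)))
          ≡⟨ ≡.cong (λ m → ∑< m (λ t → K q (i + t) * h (n ∸ suc q ∸ suc (i + t))))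
               (≡.trans (remaining q 0) (≡.cong (suc b ∸_) (ℕ.+-identityʳ q))) ⟩
        ∑< (suc b ∸ q) (λ t → K q (i + t) * h (n ∸ suc q ∸ suc (i + t)))
          ≈⟨ Σ.big<-cong (suc b ∸ q) {λ t → K q (i + t) * h (n ∸ suc q ∸ suc (i + t))}
               {λ t → D (suc (i + (q + t))) q * (ι (+ (q + t)) * h (b ∸ (q + t)))} (λ t → trans
               (*-cong (K-shift q t) (reflexive (≡.cong h (≡.trans (≡.cong (λ m → n ∸ suc q ∸ suc m) (ℕ.+-comm i t))
                 (≡.trans (remaining q (suc t)) (≡.cong (suc b ∸_) (ℕ.+-suc q t)))))))
               (*-assoc _ _ _)) ⟩
        ∑< (suc b ∸ q) (λ t → D (suc (i + (q + t))) q * (ι (+ (q + t)) * h (b ∸ (q + t))))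
          ≈⟨ ∑<-from (suc b) q (λ j → D (suc (i + j)) q * (ι (+ j) * h (b ∸ j))) ⟨
        ∑< (suc b) (cell q) ∎

    ∑-both : ∀ a b →
      ∑ (compositions (suc a)) (λ α → ∑ (filter (admissible? α) (compositions (suc b + first α))) (summand α))
        ≈ ∑< (suc a) (λ i → (ι (+ i) * h (a ∸ i)) * S b i)
    ∑-both a b = begin
      ∑ (compositions (suc a)) (λ α → ∑ (filter (admissible? α) (compositions (suc b + first α))) (summand α))
        ≈⟨ ∑-compositions-suc a (λ α → ∑ (filter (admissible? α) (compositions (suc b + first α))) (summand α)) ⟩
      ∑< (suc a) (λ i → ∑ (compositions (a ∸ i)) (second i))
        ≈⟨ Σ.big<-cong (suc a) {λ i → ∑ (compositions (a ∸ i)) (second i)} {λ i → (ι (+ i) * h (a ∸ i)) * S b i} (λ i → begin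
             ∑ (compositions (a ∸ i)) (second i)
               ≈⟨ Σ.big-cong (compositions (a ∸ i)) (λ γ → trans (∑-second b i γ)
                    (solve 3 (λ u v w → (u :* v) :* w := (u :* w) :* v) refl _ _ _)) ⟩
             ∑ (compositions (a ∸ i)) (λ γ → (ι (+ i) * S b i) * term γ)
               ≈⟨ *-∑ˡ (ι (+ i) * S b i) (compositions (a ∸ i)) term ⟨
             (ι (+ i) * S b i) * h (a ∸ i)
               ≈⟨ solve 3 (λ u v w → (u :* v) :* w := (u :* w) :* v) refl _ _ _ ⟩
             (ι (+ i) * h (a ∸ i)) * S b i ∎) ⟩
      ∑< (suc a) (λ i → (ι (+ i) * h (a ∸ i)) * S b i) ∎
      where
      second : ℕ → List ℕ → Carrier
      second i γ = ∑ (filter (admissible? (suc i ∷ γ)) (compositions (suc b + suc i))) (summand (suc i ∷ γ))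

    -- Summation over the colour of the common vertex

    W-diagonal : ∀ n {d} → d < N → W n d d ≈ ∑< (suc n) (λ i → (ι (+ i) * h (n ∸ i)) * e∖ d i)
    W-diagonal n {d} d<N = trans (W-expand n d<N d<N)
      (Σ.big<-cong (suc n) {λ i → u i d d * h (n ∸ i)} {λ i → (ι (+ i) * h (n ∸ i)) * e∖ d i} (λ i → trans
        (*-congʳ (u-diagonal i d)) (solve 3 (λ u v w → (u :* v) :* w := (u :* w) :* v) refl _ _ _)))

    ∑-W : ∀ a b → ∑< N (λ d → x d * (W a d d * W b d d)) ≈ ∑< (suc a) (λ i → (ι (+ i) * h (a ∸ i)) * S b i)
    ∑-W a b = begin
      ∑< N (λ d → x d * (W a d d * W b d d))
        ≈⟨ Σ.big<-cong-< N {λ d → x d * (W a d d * W b d d)} {λ d → ∑< (suc a) (row d)} (λ d d<N → begin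
             x d * (W a d d * W b d d)
               ≈⟨ *-congˡ (*-congʳ (W-diagonal a d<N)) ⟩
             x d * (∑< (suc a) (λ i → (ι (+ i) * h (a ∸ i)) * e∖ d i) * W b d d)
               ≈⟨ solve 3 (λ u v w → u :* (v :* w) := (u :* w) :* v) refl _ _ _ ⟩
             (x d * W b d d) * ∑< (suc a) (λ i → (ι (+ i) * h (a ∸ i)) * e∖ d i)
               ≈⟨ *-∑<ˡ (suc a) (x d * W b d d) (λ i → (ι (+ i) * h (a ∸ i)) * e∖ d i) ⟩
             ∑< (suc a) (λ i → (x d * W b d d) * ((ι (+ i) * h (a ∸ i)) * e∖ d i))
               ≈⟨ Σ.big<-cong (suc a) {λ i → (x d * W b d d) * ((ι (+ i) * h (a ∸ i)) * e∖ d i)} {row d}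
                    (λ i → solve 4 (λ y w c s → (y :* w) :* (c :* s) := c :* ((y :* s) :* w)) refl _ _ _ _) ⟩
             ∑< (suc a) (row d) ∎) ⟩
      ∑< N (λ d → ∑< (suc a) (row d))
        ≈⟨ Σ.big<-comm N (suc a) row ⟩
      ∑< (suc a) (λ i → ∑< N (λ d → row d i))
        ≈⟨ Σ.big<-cong (suc a) {λ i → ∑< N (λ d → row d i)} {λ i → (ι (+ i) * h (a ∸ i)) * S b i} (λ i → trans
             (sym (*-∑<ˡ N (ι (+ i) * h (a ∸ i)) (λ d → (x d * e∖ d i) * W b d d)))
             (*-congˡ (column i))) ⟩
      ∑< (suc a) (λ i → (ι (+ i) * h (a ∸ i)) * S b i) ∎
      where
      row : ℕ → ℕ → Carrier
      row d i = (ι (+ i) * h (a ∸ i)) * ((x d * e∖ d i) * W b d d)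

      column : ∀ i → ∑< N (λ d → (x d * e∖ d i) * W b d d) ≈ S b i
      column i = begin
        ∑< N (λ d → (x d * e∖ d i) * W b d d)
          ≈⟨ Σ.big<-cong-< N {λ d → (x d * e∖ d i) * W b d d} {λ d → ∑< (suc b) (entry d)} (λ d d<N → trans
               (*-congˡ (W-diagonal b d<N))
               (trans (*-∑<ˡ (suc b) (x d * e∖ d i) (λ j → (ι (+ j) * h (b ∸ j)) * e∖ d j))
                 (Σ.big<-cong (suc b) {λ j → (x d * e∖ d i) * ((ι (+ j) * h (b ∸ j)) * e∖ d j)} {entry d}
                   (λ j → solve 4 (λ y s c t → (y :* s) :* (c :* t) := (y :* (s :* t)) :* c) refl _ _ _ _)))) ⟩
        ∑< N (λ d → ∑< (suc b) (entry d))
          ≈⟨ Σ.big<-comm N (suc b) entry ⟩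
        ∑< (suc b) (λ j → ∑< N (λ d → entry d j))
          ≈⟨ Σ.big<-cong (suc b) {λ j → ∑< N (λ d → entry d j)} {λ j → Q i j * (ι (+ j) * h (b ∸ j))}
               (λ j → sym (*-∑<ʳ N (ι (+ j) * h (b ∸ j)) (λ d → x d * (e∖ d i * e∖ d j)))) ⟩
        S b i ∎
        where
        entry : ℕ → ℕ → Carrier
        entry d j = (x d * (e∖ d i * e∖ d j)) * (ι (+ j) * h (b ∸ j))

    ∑-proper-expand : ∀ a b →
      ∑ (filter (proper? (C (suc (suc a)) ⊕ C (suc b))) (tuples (suc a + suc b) N)) (λ κ → ∏ (toList κ) x)
        ≈ ∑ (compositions (suc (suc a))) (λ α → ∑ (filter (admissible? α) (compositions (suc b + first α))) (summand α))
    ∑-proper-expand a b = trans (∑-proper a b) (trans (∑-W (suc a) b) (sym (∑-both (suc a) b)))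

open import Defs

-- The ring of power series

module ℤΣ = Weights ℤ.+-*-commutativeRing
open ℤΣ using (∑<)

infix 8 _↓_
-- The coefficient of x₀^i, as a series in the remaining variables.
_↓_ : Series → ℕ → Series
(f ↓ i) m = f (i ∷ m)

-- In the variable x₀ the product is a Cauchy product whose coefficients are products of series in
-- the other variables. All ring laws follow from this by induction on the monomial.
⊠-∷ : ∀ f g d m → (f ⊠ g) (d ∷ m) ≡ ∑< (suc d) (λ i → (f ↓ i ⊠ g ↓ (d ∸ i)) m)
⊠-∷ f g d m = begin
  (f ⊠ g) (d ∷ m)
    ≡⟨ ℤΣ.Σ.big-map (product f g) (splittings (d ∷ m)) id ⟩
  ℤΣ.∑ (splittings (d ∷ m)) (product f g)
    ≡⟨ ℤΣ.Σ.big-cartesianProductWith (λ i (p , q) → (i ∷ p) , (d ∸ i ∷ q)) (upTo (suc d)) (splittings m) (product f g) ⟩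
  ℤΣ.∑ (upTo (suc d)) (λ i → ℤΣ.∑ (splittings m) (product (f ↓ i) (g ↓ (d ∸ i))))
    ≡⟨ ℤΣ.Σ.big-cong (upTo (suc d)) (λ i → ≡.sym (ℤΣ.Σ.big-map (product (f ↓ i) (g ↓ (d ∸ i))) (splittings m) id)) ⟩
  ℤΣ.∑ (upTo (suc d)) (λ i → (f ↓ i ⊠ g ↓ (d ∸ i)) m)
    ≡⟨ ℤΣ.Σ.big-upTo (suc d) (λ i → (f ↓ i ⊠ g ↓ (d ∸ i)) m) ⟩
  ∑< (suc d) (λ i → (f ↓ i ⊠ g ↓ (d ∸ i)) m) ∎
  where
  open ≡-Reasoning
  product : Series → Series → Monomial × Monomial → ℤ
  product f g (p , q) = f p ℤ.* g q

∑<-cong : ∀ n {f g : ℕ → ℤ} → (∀ i → f i ≡ g i) → ∑< n f ≡ ∑< n g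
∑<-cong n {f} {g} = ℤΣ.Σ.big<-cong n {f} {g}

infix 4 _≈[_]_
_≈[_]_ : Series → ℕ → Series → Set
f ≈[ N ] g = ∀ m → length m ≡ N → f m ≡ g m

-- Both halves of a splitting have the length of the monomial that is split, so agreement on
-- monomials of length N is preserved by products.
⊠-cong : ∀ {N f f′ g g′} → f ≈[ N ] f′ → g ≈[ N ] g′ → f ⊠ g ≈[ N ] f′ ⊠ g′
⊠-cong f≈f′ g≈g′ [] N≡ = ≡.cong₂ (λ a b → a ℤ.* b ℤ.+ 0ℤ) (f≈f′ [] N≡) (g≈g′ [] N≡)
⊠-cong {f = f} {f′} {g} {g′} f≈f′ g≈g′ (d ∷ m) ≡.refl = ≡.trans (⊠-∷ f g d m) (≡.trans
  (∑<-cong (suc d) {λ i → (f ↓ i ⊠ g ↓ (d ∸ i)) m} {λ i → (f′ ↓ i ⊠ g′ ↓ (d ∸ i)) m}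
    (λ i → ⊠-cong (λ m m≡ → f≈f′ (i ∷ m) (≡.cong suc m≡)) (λ m m≡ → g≈g′ (d ∸ i ∷ m) (≡.cong suc m≡)) m ≡.refl))
  (≡.sym (⊠-∷ f′ g′ d m)))

⊠-comm : ∀ f g → f ⊠ g ≈ g ⊠ f
⊠-comm f g []      = ≡.cong (ℤ._+ 0ℤ) (ℤ.*-comm (f []) (g []))
⊠-comm f g (d ∷ m) = begin
  (f ⊠ g) (d ∷ m)                             ≡⟨ ⊠-∷ f g d m ⟩
  ∑< (suc d) (λ i → (f ↓ i ⊠ g ↓ (d ∸ i)) m)
    ≡⟨ ∑<-cong (suc d) {λ i → (f ↓ i ⊠ g ↓ (d ∸ i)) m} {λ i → (g ↓ (d ∸ i) ⊠ f ↓ i) m}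
         (λ i → ⊠-comm (f ↓ i) (g ↓ (d ∸ i)) m) ⟩
  ∑< (suc d) (λ i → (g ↓ (d ∸ i) ⊠ f ↓ i) m)  ≡⟨ ℤΣ.Σ.big<-reverse d (λ i j → (g ↓ j ⊠ f ↓ i) m) ⟩
  ∑< (suc d) (λ i → (g ↓ i ⊠ f ↓ (d ∸ i)) m)  ≡⟨ ⊠-∷ g f d m ⟨
  (g ⊠ f) (d ∷ m)                             ∎
  where open ≡-Reasoning

⊠-distribˡ : ∀ f g h → f ⊠ (g ⊞ h) ≈ f ⊠ g ⊞ f ⊠ h
⊠-distribˡ f g h [] = lemma (f []) (g []) (h [])
  where
  lemma : ∀ a b c → a ℤ.* (b ℤ.+ c) ℤ.+ 0ℤ ≡ (a ℤ.* b ℤ.+ 0ℤ) ℤ.+ (a ℤ.* c ℤ.+ 0ℤ)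
  lemma = solve-∀
⊠-distribˡ f g h (d ∷ m) = begin
  (f ⊠ (g ⊞ h)) (d ∷ m)                                ≡⟨ ⊠-∷ f (g ⊞ h) d m ⟩
  ∑< (suc d) (λ i → (f ↓ i ⊠ (g ↓ (d ∸ i) ⊞ h ↓ (d ∸ i))) m)
    ≡⟨ ∑<-cong (suc d) {λ i → (f ↓ i ⊠ (g ↓ (d ∸ i) ⊞ h ↓ (d ∸ i))) m} {λ i → fg i ℤ.+ fh i}
         (λ i → ⊠-distribˡ (f ↓ i) (g ↓ (d ∸ i)) (h ↓ (d ∸ i)) m) ⟩
  ∑< (suc d) (λ i → fg i ℤ.+ fh i)                     ≡⟨ ℤΣ.Σ.big<-∙ (suc d) fg fh ⟩
  ∑< (suc d) fg ℤ.+ ∑< (suc d) fh                      ≡⟨ ≡.cong₂ ℤ._+_ (⊠-∷ f g d m) (⊠-∷ f h d m) ⟨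
  (f ⊠ g ⊞ f ⊠ h) (d ∷ m)                              ∎
  where
  open ≡-Reasoning
  fg fh : ℕ → ℤ
  fg i = (f ↓ i ⊠ g ↓ (d ∸ i)) m
  fh i = (f ↓ i ⊠ h ↓ (d ∸ i)) m

⊠-distribʳ : ∀ f g h → (g ⊞ h) ⊠ f ≈ g ⊠ f ⊞ h ⊠ f
⊠-distribʳ f g h m = begin
  ((g ⊞ h) ⊠ f) m                ≡⟨ ⊠-comm (g ⊞ h) f m ⟩
  (f ⊠ (g ⊞ h)) m                ≡⟨ ⊠-distribˡ f g h m ⟩
  (f ⊠ g) m ℤ.+ (f ⊠ h) m        ≡⟨ ≡.cong₂ ℤ._+_ (⊠-comm f g m) (⊠-comm f h m) ⟩
  (g ⊠ f) m ℤ.+ (h ⊠ f) m        ∎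
  where open ≡-Reasoning

·-⊠ : ∀ c f g → (c · f) ⊠ g ≈ c · (f ⊠ g)
·-⊠ c f g [] = lemma c (f []) (g [])
  where
  lemma : ∀ a b c → (a ℤ.* b) ℤ.* c ℤ.+ 0ℤ ≡ a ℤ.* (b ℤ.* c ℤ.+ 0ℤ)
  lemma = solve-∀
·-⊠ c f g (d ∷ m) = begin
  ((c · f) ⊠ g) (d ∷ m)                               ≡⟨ ⊠-∷ (c · f) g d m ⟩
  ∑< (suc d) (λ i → ((c · f ↓ i) ⊠ g ↓ (d ∸ i)) m)
    ≡⟨ ∑<-cong (suc d) {λ i → ((c · f ↓ i) ⊠ g ↓ (d ∸ i)) m} {λ i → c ℤ.* (f ↓ i ⊠ g ↓ (d ∸ i)) m}
         (λ i → ·-⊠ c (f ↓ i) (g ↓ (d ∸ i)) m) ⟩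
  ∑< (suc d) (λ i → c ℤ.* (f ↓ i ⊠ g ↓ (d ∸ i)) m)    ≡⟨ ℤΣ.*-∑<ˡ (suc d) c (λ i → (f ↓ i ⊠ g ↓ (d ∸ i)) m) ⟨
  c ℤ.* ∑< (suc d) (λ i → (f ↓ i ⊠ g ↓ (d ∸ i)) m)    ≡⟨ ≡.cong (c ℤ.*_) (⊠-∷ f g d m) ⟨
  (c · (f ⊠ g)) (d ∷ m)                               ∎
  where open ≡-Reasoning

⊠-zeroˡ : ∀ f → 𝟘 ⊠ f ≈ 𝟘
-- `0ℤ · f` computes to `𝟘`, whatever `f` is.
⊠-zeroˡ f = ·-⊠ 0ℤ 𝟘 f

⊠-identityˡ : ∀ f → 𝟙 ⊠ f ≈ f
⊠-identityˡ f []      = ≡.trans (ℤ.+-identityʳ _) (ℤ.*-identityˡ _)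
⊠-identityˡ f (d ∷ m) = begin
  (𝟙 ⊠ f) (d ∷ m)                                                        ≡⟨ ⊠-∷ 𝟙 f d m ⟩
  (𝟙 ⊠ f ↓ d) m ℤ.+ ∑< d (λ i → (𝟘 ⊠ f ↓ (d ∸ suc i)) m)
    ≡⟨ ≡.cong₂ ℤ._+_ (⊠-identityˡ (f ↓ d) m)
         (ℤΣ.Σ.big<-ε d {λ i → (𝟘 ⊠ f ↓ (d ∸ suc i)) m} (λ i → ⊠-zeroˡ (f ↓ (d ∸ suc i)) m)) ⟩
  f (d ∷ m) ℤ.+ 0ℤ                                                       ≡⟨ ℤ.+-identityʳ _ ⟩
  f (d ∷ m)                                                              ∎
  where open ≡-Reasoning

∑<ˢ : ℕ → (ℕ → Series) → Series
∑<ˢ n F m = ∑< n (λ j → F j m)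

⊠-∑<ʳ : ∀ n (F : ℕ → Series) g → ∑<ˢ n F ⊠ g ≈ ∑<ˢ n (λ j → F j ⊠ g)
⊠-∑<ʳ zero    F g m = ⊠-zeroˡ g m
⊠-∑<ʳ (suc n) F g m =
  ≡.trans (⊠-distribʳ g (F 0) (∑<ˢ n (F ∘ suc)) m) (≡.cong (λ z → (F 0 ⊠ g) m ℤ.+ z) (⊠-∑<ʳ n (F ∘ suc) g m))

⊠-∑<ˡ : ∀ n f (G : ℕ → Series) → f ⊠ ∑<ˢ n G ≈ ∑<ˢ n (λ j → f ⊠ G j)
⊠-∑<ˡ n f G m = ≡.trans (⊠-comm f (∑<ˢ n G) m) (≡.trans (⊠-∑<ʳ n G f m)
  (∑<-cong n {λ j → (G j ⊠ f) m} {λ j → (f ⊠ G j) m} (λ j → ⊠-comm (G j) f m)))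

⊠-assoc : ∀ f g h → (f ⊠ g) ⊠ h ≈ f ⊠ (g ⊠ h)
⊠-assoc f g h [] = lemma (f []) (g []) (h [])
  where
  lemma : ∀ a b c → (a ℤ.* b ℤ.+ 0ℤ) ℤ.* c ℤ.+ 0ℤ ≡ a ℤ.* (b ℤ.* c ℤ.+ 0ℤ) ℤ.+ 0ℤ
  lemma = solve-∀
⊠-assoc f g h (d ∷ m) = begin
  ((f ⊠ g) ⊠ h) (d ∷ m)
    ≡⟨ ⊠-∷ (f ⊠ g) h d m ⟩
  ∑< (suc d) (λ i → ((f ⊠ g) ↓ i ⊠ h ↓ (d ∸ i)) m)
    ≡⟨ ∑<-cong (suc d) {λ i → ((f ⊠ g) ↓ i ⊠ h ↓ (d ∸ i)) m}
         {λ i → ∑< (suc i) (λ j → G j (i ∸ j) (d ∸ i))} (λ i → begin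
         ((f ⊠ g) ↓ i ⊠ h ↓ (d ∸ i)) m
           ≡⟨ ⊠-cong {g = h ↓ (d ∸ i)} (λ m _ → ⊠-∷ f g i m) (λ _ _ → ≡.refl) m ≡.refl ⟩
         (∑<ˢ (suc i) (λ j → f ↓ j ⊠ g ↓ (i ∸ j)) ⊠ h ↓ (d ∸ i)) m
           ≡⟨ ⊠-∑<ʳ (suc i) (λ j → f ↓ j ⊠ g ↓ (i ∸ j)) (h ↓ (d ∸ i)) m ⟩
         ∑< (suc i) (λ j → ((f ↓ j ⊠ g ↓ (i ∸ j)) ⊠ h ↓ (d ∸ i)) m)
           ≡⟨ ∑<-cong (suc i) {λ j → ((f ↓ j ⊠ g ↓ (i ∸ j)) ⊠ h ↓ (d ∸ i)) m} {λ j → G j (i ∸ j) (d ∸ i)}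
                (λ j → ⊠-assoc (f ↓ j) (g ↓ (i ∸ j)) (h ↓ (d ∸ i)) m) ⟩
         ∑< (suc i) (λ j → G j (i ∸ j) (d ∸ i)) ∎) ⟩
  ∑< (suc d) (λ i → ∑< (suc i) (λ j → G j (i ∸ j) (d ∸ i)))
    -- The exponents of x₀ in the three factors are j, i and k, with sum d.
    ≡⟨ ℤΣ.Σ.big<-triangle d G ⟩
  ∑< (suc d) (λ j → ∑< (suc (d ∸ j)) (λ i → G j i (d ∸ j ∸ i)))
    ≡⟨ ∑<-cong (suc d) {λ j → (f ↓ j ⊠ (g ⊠ h) ↓ (d ∸ j)) m}
         {λ j → ∑< (suc (d ∸ j)) (λ i → G j i (d ∸ j ∸ i))} (λ j → begin
         (f ↓ j ⊠ (g ⊠ h) ↓ (d ∸ j)) m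
           ≡⟨ ⊠-cong {f = f ↓ j} (λ _ _ → ≡.refl) (λ m _ → ⊠-∷ g h (d ∸ j) m) m ≡.refl ⟩
         (f ↓ j ⊠ ∑<ˢ (suc (d ∸ j)) (λ i → g ↓ i ⊠ h ↓ (d ∸ j ∸ i))) m
           ≡⟨ ⊠-∑<ˡ (suc (d ∸ j)) (f ↓ j) (λ i → g ↓ i ⊠ h ↓ (d ∸ j ∸ i)) m ⟩
         ∑< (suc (d ∸ j)) (λ i → G j i (d ∸ j ∸ i)) ∎) ⟨
  ∑< (suc d) (λ j → (f ↓ j ⊠ (g ⊠ h) ↓ (d ∸ j)) m)
    ≡⟨ ⊠-∷ f (g ⊠ h) d m ⟨
  (f ⊠ (g ⊠ h)) (d ∷ m) ∎
  where
  open ≡-Reasoning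
  G : ℕ → ℕ → ℕ → ℤ
  G j i k = (f ↓ j ⊠ (g ↓ i ⊠ h ↓ k)) m

-- Equality is restricted to the monomials in x₀, …, x_{N-1}, on which the infinite
-- sums ∑∞ are finite.
seriesRing : ℕ → CommutativeRing 0ℓ 0ℓ
seriesRing N = record
  { Carrier = Series
  ; _≈_     = _≈[ N ]_
  ; _+_     = _⊞_
  ; _*_     = _⊠_
  ; -_      = λ f m → ℤ.- f m
  ; 0#      = 𝟘
  ; 1#      = 𝟙
  ; isCommutativeRing = record
    { isRing = record
      { +-isAbelianGroup = record
        { isGroup = record
          { isMonoid = record
            { isSemigroup = record
              { isMagma = record
                { isEquivalence = record
                  { refl  = λ _ _ → ≡.refl
                  ; sym   = λ f≈g m m≡ → ≡.sym (f≈g m m≡)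
                  ; trans = λ f≈g g≈h m m≡ → ≡.trans (f≈g m m≡) (g≈h m m≡)
                  }
                ; ∙-cong = λ f≈f′ g≈g′ m m≡ → ≡.cong₂ ℤ._+_ (f≈f′ m m≡) (g≈g′ m m≡)
                }
              ; assoc = λ f g h m _ → ℤ.+-assoc (f m) (g m) (h m)
              }
            ; identity = (λ f m _ → ℤ.+-identityˡ (f m)) , (λ f m _ → ℤ.+-identityʳ (f m))
            }
          ; inverse = (λ f m _ → ℤ.+-inverseˡ (f m)) , (λ f m _ → ℤ.+-inverseʳ (f m))
          ; ⁻¹-cong = λ f≈g m m≡ → ≡.cong ℤ.-_ (f≈g m m≡)
          }
        ; comm = λ f g m _ → ℤ.+-comm (f m) (g m)
        }
      ; *-cong     = λ {f} {f′} {g} {g′} → ⊠-cong {N} {f} {f′} {g} {g′}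
      ; *-assoc    = λ f g h m _ → ⊠-assoc f g h m
      ; *-identity = (λ f m _ → ⊠-identityˡ f m) , (λ f m _ → ≡.trans (⊠-comm f 𝟙 m) (⊠-identityˡ f m))
      ; distrib    = (λ f g h m _ → ⊠-distribˡ f g h m) , (λ f g h m _ → ⊠-distribʳ f g h m)
      }
    ; *-comm = λ f g m _ → ⊠-comm f g m
    }
  }

constant : ℤ → Series
constant c = c · 𝟙

constant-⊠ : ∀ c f → constant c ⊠ f ≈ c · f
constant-⊠ c f m = ≡.trans (·-⊠ c 𝟙 f m) (≡.cong (c ℤ.*_) (⊠-identityˡ f m))

constant-homo : ∀ N → IsRingHomomorphism ℤ.+-*-rawRing (CommutativeRing.rawRing (seriesRing N)) constant
constant-homo N = record
  { isSemiringHomomorphism = record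
    { isNearSemiringHomomorphism = record
      { +-isMonoidHomomorphism = record
        { isMagmaHomomorphism = record
          { isRelHomomorphism = record { cong = λ { ≡.refl _ _ → ≡.refl } }
          ; homo = λ c d m _ → ℤ.*-distribʳ-+ (𝟙 m) c d
          }
        ; ε-homo = λ _ _ → ≡.refl
        }
      ; *-homo = λ c d m _ → ≡.trans (ℤ.*-assoc c d (𝟙 m)) (≡.sym (constant-⊠ c (constant d) m))
      }
    ; 1#-homo = λ m _ → ℤ.*-identityˡ (𝟙 m)
    }
  ; -‿homo = λ c m _ → ≡.sym (ℤ.neg-distribˡ-* c (𝟙 m))
  }

mainTheorem4 : (a b : ℕ) → 2 ≤ a → 2 ≤ b →
    X (C a ⊕ C b)
    ≈ (∑[ α ← compositions a ]
    ∑[ β ← filter (admissible? α) (compositions (b + first α)) ]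
    coefficient α β · e[ sort (parts α β) ])
-- One coefficient at a time: N is the length of the given monomial `m`, so at `m` the series `X` is
-- by definition the finite sum over colourings with N colours.
mainTheorem4 (suc (suc a)) (suc b) (s≤s (s≤s _)) (s≤s _) m = trans (∑-proper-expand N x a b)
  (big-cong (compositions (suc (suc a))) (λ α →
    big-cong (filter (admissible? α) (compositions (suc b + first α))) (e-parts α))) m ≡.refl
  where
  N : ℕ
  N = length m
  open CommutativeRing (seriesRing N) using (trans; sym; *-cong; refl)
  open Weights (seriesRing N) using (∑-linked; module Σ; module Π)
  open Σ using (big-cong)
  open Expansion (seriesRing N) constant (constant-homo N) using (∑-proper-expand; summand)

  e-parts : ∀ α β → summand N x α β ≈[ N ] coefficient α β · e[ sort (parts α β) ]
  e-parts α β = trans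
    (*-cong {constant (coefficient α β)} (λ _ _ → ≡.refl)
      -- Sorting only permutes the factors of the product.
      (trans (Π.big-↭ (Expansion.e (seriesRing N) constant (constant-homo N) N x) (↭-sym (sort-↭ (parts α β))))
             (Π.big-cong (sort (parts α β)) (λ k → sym (e≈elementary k)))))
    (λ m _ → constant-⊠ (coefficient α β) e[ sort (parts α β) ] m)
    where
    e≈elementary : ∀ k → e k ≈[ N ] Expansion.e (seriesRing N) constant (constant-homo N) N x k
    e≈elementary k m′ m′≡N = ≡.trans
      -- The number of variables of `e k` at `m′` is `length m′`, which has to be replaced by N
      -- first.
      (≡.cong (λ n → (∑[ i ← filter (Linked.linked? _<?_) (tuples k n) ] ∏[ j ← toList i ] x j) m′) m′≡N)
      (∑-linked k N x m′ m′≡N)
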